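{- Consider the following posets $P$ with typings $t$ (each typing is surjective onto $\mathbb{N}$): (i) $\mathbb{N}$ under divisibility, with $t(n,m)=m/n$ for $n\mid m$; (ii) the finite subsets $\mathscr{F}(\mathbb{N})$ of $\mathbb{N}$ under inclusion, with $t(S,T)=|T|-|S|+1$ for $S\subseteq T$; (iii) the finite-dimensional subspaces $\mathscr{V}(\mathbb{F}_q^\infty)$ of $\mathbb{F}_q^\infty$ under inclusion, with $t(U,V)=\dim V-\dim U+1$ for $U\subseteq V$; (iv) $\mathbb{N}$ under the usual order $\leqslant$, with $t(n,m)=m-n+1$ for $n\leqslant m$. Then the posets (i), (ii), (iii) have the reduced Möbius uncertainty property $\mathcal{R}$, while the poset (iv) does not.
   Context: Let $P$ be a locally finite poset. A typing is a map $t:P\times P\to\mathbb{N}\cup\{0\}$ with $t(x,y)\neq0$ iff $x\leqslant y$, such that the convolution $(f_1*f_2)(x,y)=\sum_{x\leqslant z\leqslant y}f_1(x,z)f_2(z,y)$ of two functions whose values depend only on $t(x,y)$ again depends only on $t(x,y)$. For a surjective typing, let $\left[\begin{smallmatrix} n\\ d\ \ k\end{smallmatrix}\right]$ denote the number of $z$ in an interval $[x,y]$ of type $n$ with $[x,z]$ of type $d$ and $[z,y]$ of type $k$ (independent of the choice of interval). $(P,t)$ has property $\mathcal{R}$ if for all functions $f,g:\mathbb{N}\to\mathbb{C}$, neither identically zero, satisfying $g(n)=\sum_{d,k\in\mathbb{N}}\left[\begin{smallmatrix} n\\ d\ \ k\end{smallmatrix}\right] f(k)$ for all $n\in\mathbb{N}$,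 at least one of $\{n: f(n)\neq 0\}$ and $\{n:g(n)\neq0\}$ is infinite. Concretely, the relation $g=\zeta*f$ reads: in (i) $g(n)=\sum_{d\mid n}f(d)$; in (ii) $g(n)=\sum_{k=1}^n\binom{n-1}{k-1}f(k)$; in (iii) $g(n)=\sum_{k=1}^n\binom{n-1}{k-1}_q f(k)$ with the Gaussian binomial coefficient; in (iv) $g(n)=\sum_{k=1}^n f(k)$. -}

module Defs where

open import Algebra.Bundles using (CommutativeRing)
open import Algebra.Bundles.Raw using (RawRing)
import Algebra.Definitions.RawMonoid as RawMonoidOps
open import Algebra.Module.Bundles.Raw using (RawLeftSemimodule)
open import Data.Fin.Base using (Fin; toℕ)
open import Data.List.Base using (List; length; map; foldr; filter)
import Data.List.Membership.Propositional as Mem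
import Data.List.Membership.Setoid as SetoidMem
open import Data.List.Relation.Binary.Subset.Propositional using (_⊆_)
open import Data.List.Relation.Binary.Subset.Propositional.Properties using (⊆-refl; ⊆-trans)
open import Data.List.Relation.Unary.Unique.Propositional using (Unique)
import Data.List.Relation.Unary.Unique.Setoid as SetoidUnique
open import Data.Nat.Base as ℕ using (ℕ; suc; _⊔_)
import Data.Nat.Divisibility as ℕ
import Data.Nat.Properties as ℕ
open import Data.Product.Base using (∃-syntax; _×_; _,_; proj₁; proj₂)
open import Data.Rational.Base as ℚ using (ℚ; 0ℚ; 1ℚ; ½; ∣_∣; _<_; Positive; positive; 1/_)
import Data.Rational.Properties as ℚ
open import Data.Rational.Solver using (module +-*-Solver)
open import Data.Sum.Base using (_⊎_)
open import Data.Vec.Functional using (Vector)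
open import Function.Bundles using (_⇔_; Inverse)
open import Level using (Level; 0ℓ) renaming (suc to lsuc; _⊔_ to _l⊔_)
open import Relation.Binary.Bundles using (Poset)
import Relation.Binary.Construct.Interior.Symmetric as Interior
import Relation.Binary.Construct.On as On
open import Relation.Binary.PropositionalEquality
  using (_≡_; _≢_; refl; sym; trans; cong; subst; module ≡-Reasoning)
open import Relation.Binary.PropositionalEquality.Properties using () renaming (setoid to ≡-setoid)
open import Relation.Nullary using (¬_)
open import Relation.Nullary.Decidable using (_×-dec_)

private
  variable
    c ℓ ℓ₁ ℓ₂ : Level

-- Real and complex numbers: ℝ is the setoid of Cauchy sequences of
-- rationals modulo null sequences, and ℂ consists of pairs of reals.

IsCauchy : (ℕ → ℚ) → Set
IsCauchy x = ∀ ε → 0ℚ < ε →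
  ∃[ N ] ∀ m n → N ℕ.≤ m → N ℕ.≤ n → ∣ x m ℚ.- x n ∣ < ε

record ℝ : Set where
  constructor mkℝ
  field
    seq    : ℕ → ℚ
    cauchy : IsCauchy seq

open ℝ public

infix 4 _≈ℝ_
_≈ℝ_ : ℝ → ℝ → Set
x ≈ℝ y = ∀ ε → 0ℚ < ε → ∃[ N ] ∀ n → N ℕ.≤ n → ∣ seq x n ℚ.- seq y n ∣ < ε

private abstract
  half-positive : ∀ ε → 0ℚ < ε → 0ℚ < ½ ℚ.* ε
  half-positive ε ε>0 = ℚ.positive⁻¹ (½ ℚ.* ε) {{ℚ.pos*pos⇒pos ½ ε {{positive ε>0}}}}

  half+half : ∀ ε → ½ ℚ.* ε ℚ.+ ½ ℚ.* ε ≡ ε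
  half+half ε = trans (sym (ℚ.*-distribʳ-+ ε ½ ½)) (ℚ.*-identityˡ ε)

  const-cauchy : ∀ p → IsCauchy (λ _ → p)
  const-cauchy p ε ε>0 = 0 , λ _ _ _ _ →
    subst (_< ε) (sym (cong ∣_∣ (ℚ.+-inverseʳ p))) ε>0

  neg-cauchy : ∀ x → IsCauchy x → IsCauchy (λ n → ℚ.- x n)
  neg-cauchy x cx ε ε>0 with cx ε ε>0
  ... | N , h = N , λ m n N≤m N≤n → subst (_< ε)
    (trans (sym (ℚ.∣-p∣≡∣p∣ (x m ℚ.- x n)))
           (cong ∣_∣ (ℚ.neg-distrib-+ (x m) (ℚ.- x n))))
    (h m n N≤m N≤n)

  +-cauchy : ∀ x y → IsCauchy x → IsCauchy y → IsCauchy (λ n → x n ℚ.+ y n)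
  +-cauchy x y cx cy ε ε>0
    with cx (½ ℚ.* ε) (half-positive ε ε>0) | cy (½ ℚ.* ε) (half-positive ε ε>0)
  ... | M , hx | N , hy = M ⊔ N , λ m n m≥ n≥ → begin-strict
      ∣ (x m ℚ.+ y m) ℚ.- (x n ℚ.+ y n) ∣
        ≡⟨ cong ∣_∣ (rearrange (x m) (y m) (x n) (y n)) ⟩
      ∣ (x m ℚ.- x n) ℚ.+ (y m ℚ.- y n) ∣
        ≤⟨ ℚ.∣p+q∣≤∣p∣+∣q∣ (x m ℚ.- x n) (y m ℚ.- y n) ⟩
      ∣ x m ℚ.- x n ∣ ℚ.+ ∣ y m ℚ.- y n ∣
        <⟨ ℚ.+-mono-<
             (hx m n (ℕ.m⊔n≤o⇒m≤o M N m≥) (ℕ.m⊔n≤o⇒m≤o M N n≥))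
             (hy m n (ℕ.m⊔n≤o⇒n≤o M N m≥) (ℕ.m⊔n≤o⇒n≤o M N n≥)) ⟩
      ½ ℚ.* ε ℚ.+ ½ ℚ.* ε
        ≡⟨ half+half ε ⟩
      ε ∎
    where
    open ℚ.≤-Reasoning
    open +-*-Solver
    rearrange : ∀ a b a′ b′ →
      (a ℚ.+ b) ℚ.- (a′ ℚ.+ b′) ≡ (a ℚ.- a′) ℚ.+ (b ℚ.- b′)
    rearrange = solve 4 (λ a b a′ b′ →
      (a :+ b) :+ :- (a′ :+ b′) := (a :+ :- a′) :+ (b :+ :- b′)) refl

  eventually-bounded : ∀ x → IsCauchy x →
    ∃[ B ] Positive B × ∃[ N ] ∀ n → N ℕ.≤ n → ∣ x n ∣ ℚ.≤ B
  eventually-bounded x cx with cx 1ℚ (ℚ.positive⁻¹ 1ℚ)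
  ... | N , h = 1ℚ ℚ.+ ∣ x N ∣ , B>0 , N , bound
    where
    open ℚ.≤-Reasoning
    B>0 : Positive (1ℚ ℚ.+ ∣ x N ∣)
    B>0 = positive (ℚ.+-mono-<-≤ (ℚ.positive⁻¹ 1ℚ) (ℚ.0≤∣p∣ (x N)))
    split : ∀ a b → a ≡ (a ℚ.- b) ℚ.+ b
    split = let open +-*-Solver in solve 2 (λ a b → a := (a :+ :- b) :+ b) refl
    bound : ∀ n → N ℕ.≤ n → ∣ x n ∣ ℚ.≤ 1ℚ ℚ.+ ∣ x N ∣
    bound n N≤n = begin
      ∣ x n ∣                       ≡⟨ cong ∣_∣ (split (x n) (x N)) ⟩
      ∣ (x n ℚ.- x N) ℚ.+ x N ∣      ≤⟨ ℚ.∣p+q∣≤∣p∣+∣q∣ (x n ℚ.- x N) (x N) ⟩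
      ∣ x n ℚ.- x N ∣ ℚ.+ ∣ x N ∣    ≤⟨ ℚ.+-monoˡ-≤ ∣ x N ∣ (ℚ.<⇒≤ (h n N N≤n ℕ.≤-refl)) ⟩
      1ℚ ℚ.+ ∣ x N ∣                ∎

  product-bound : ∀ {C δ} p d → Positive C → ∣ p ∣ ℚ.≤ C → ∣ d ∣ < δ → ∣ p ℚ.* d ∣ < C ℚ.* δ
  product-bound {C} {δ} p d C>0 ∣p∣≤C ∣d∣<δ = begin-strict
    ∣ p ℚ.* d ∣      ≡⟨ ℚ.∣p*q∣≡∣p∣*∣q∣ p d ⟩
    ∣ p ∣ ℚ.* ∣ d ∣  ≤⟨ ℚ.*-monoʳ-≤-nonNeg ∣ d ∣ {{ℚ.nonNegative (ℚ.0≤∣p∣ d)}} ∣p∣≤C ⟩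
    C ℚ.* ∣ d ∣      <⟨ ℚ.*-monoʳ-<-pos C {{C>0}} ∣d∣<δ ⟩
    C ℚ.* δ          ∎
    where open ℚ.≤-Reasoning

  divide : ∀ C ε → Positive C → 0ℚ < ε → ∃[ δ ] 0ℚ < δ × C ℚ.* δ ≡ ε
  divide C ε C>0 ε>0 = C⁻¹ ℚ.* ε , δ>0 , (begin
      C ℚ.* (C⁻¹ ℚ.* ε)  ≡⟨ ℚ.*-assoc C C⁻¹ ε ⟨
      C ℚ.* C⁻¹ ℚ.* ε    ≡⟨ cong (ℚ._* ε) (ℚ.*-inverseʳ C {{ℚ.pos⇒nonZero C {{C>0}}}}) ⟩
      1ℚ ℚ.* ε           ≡⟨ ℚ.*-identityˡ ε ⟩
      ε                  ∎)
    where
    open ≡-Reasoning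
    C⁻¹ : ℚ
    C⁻¹ = (1/ C) {{ℚ.pos⇒nonZero C {{C>0}}}}
    δ>0 : 0ℚ < C⁻¹ ℚ.* ε
    δ>0 = ℚ.positive⁻¹ (C⁻¹ ℚ.* ε)
      {{ℚ.pos*pos⇒pos C⁻¹ {{ℚ.1/pos⇒pos C {{C>0}}}} ε {{positive ε>0}}}}

  product-difference : ∀ {A B δ ε} a b a′ b′ → Positive A → Positive B →
    (A ℚ.+ B) ℚ.* δ ≡ ε → ∣ a ∣ ℚ.≤ A → ∣ b′ ∣ ℚ.≤ B →
    ∣ a ℚ.- a′ ∣ < δ → ∣ b ℚ.- b′ ∣ < δ → ∣ a ℚ.* b ℚ.- a′ ℚ.* b′ ∣ < ε
  product-difference {A} {B} {δ} {ε} a b a′ b′ A>0 B>0 eq ∣a∣≤A ∣b′∣≤B da db = begin-strict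
    ∣ a ℚ.* b ℚ.- a′ ℚ.* b′ ∣
      ≡⟨ cong ∣_∣ (rearrange a b a′ b′) ⟩
    ∣ a ℚ.* (b ℚ.- b′) ℚ.+ b′ ℚ.* (a ℚ.- a′) ∣
      ≤⟨ ℚ.∣p+q∣≤∣p∣+∣q∣ (a ℚ.* (b ℚ.- b′)) (b′ ℚ.* (a ℚ.- a′)) ⟩
    ∣ a ℚ.* (b ℚ.- b′) ∣ ℚ.+ ∣ b′ ℚ.* (a ℚ.- a′) ∣
      <⟨ ℚ.+-mono-< (product-bound a (b ℚ.- b′) A>0 ∣a∣≤A db)
                    (product-bound b′ (a ℚ.- a′) B>0 ∣b′∣≤B da) ⟩
    A ℚ.* δ ℚ.+ B ℚ.* δ
      ≡⟨ ℚ.*-distribʳ-+ δ A B ⟨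
    (A ℚ.+ B) ℚ.* δ
      ≡⟨ eq ⟩
    ε ∎
    where
    open ℚ.≤-Reasoning
    rearrange : ∀ a b a′ b′ →
      a ℚ.* b ℚ.- a′ ℚ.* b′ ≡ a ℚ.* (b ℚ.- b′) ℚ.+ b′ ℚ.* (a ℚ.- a′)
    rearrange = let open +-*-Solver in solve 4 (λ a b a′ b′ →
      a :* b :+ :- (a′ :* b′) := a :* (b :+ :- b′) :+ b′ :* (a :+ :- a′)) refl

  *-cauchy : ∀ x y → IsCauchy x → IsCauchy y → IsCauchy (λ n → x n ℚ.* y n)
  *-cauchy x y cx cy ε ε>0 =
    let A , A>0 , M , ∣x∣≤A = eventually-bounded x cx
        B , B>0 , N , ∣y∣≤B = eventually-bounded y cy
        δ , δ>0 , eq = divide (A ℚ.+ B) ε (ℚ.pos+pos⇒pos A {{A>0}} B {{B>0}}) ε>0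
        K , hx = cx δ δ>0
        L , hy = cy δ δ>0
    in M ⊔ N ⊔ (K ⊔ L) , λ m n m≥ n≥ →
      let mMN = ℕ.m⊔n≤o⇒m≤o (M ⊔ N) (K ⊔ L) m≥
          nMN = ℕ.m⊔n≤o⇒m≤o (M ⊔ N) (K ⊔ L) n≥
          mKL = ℕ.m⊔n≤o⇒n≤o (M ⊔ N) (K ⊔ L) m≥
          nKL = ℕ.m⊔n≤o⇒n≤o (M ⊔ N) (K ⊔ L) n≥
      in product-difference (x m) (y m) (x n) (y n) A>0 B>0 eq
           (∣x∣≤A m (ℕ.m⊔n≤o⇒m≤o M N mMN))
           (∣y∣≤B n (ℕ.m⊔n≤o⇒n≤o M N nMN))
           (hx m n (ℕ.m⊔n≤o⇒m≤o K L mKL) (ℕ.m⊔n≤o⇒m≤o K L nKL))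
           (hy m n (ℕ.m⊔n≤o⇒n≤o K L mKL) (ℕ.m⊔n≤o⇒n≤o K L nKL))

ℚ⇒ℝ : ℚ → ℝ
ℚ⇒ℝ p = mkℝ (λ _ → p) (const-cauchy p)

infixl 6 _+ℝ_
infixl 7 _*ℝ_
infix  8 -ℝ_

_+ℝ_ : ℝ → ℝ → ℝ
x +ℝ y = mkℝ (λ n → seq x n ℚ.+ seq y n) (+-cauchy (seq x) (seq y) (cauchy x) (cauchy y))

_*ℝ_ : ℝ → ℝ → ℝ
x *ℝ y = mkℝ (λ n → seq x n ℚ.* seq y n) (*-cauchy (seq x) (seq y) (cauchy x) (cauchy y))

-ℝ_ : ℝ → ℝ
-ℝ x = mkℝ (λ n → ℚ.- seq x n) (neg-cauchy (seq x) (cauchy x))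

record ℂ : Set where
  constructor _+i_
  field
    re : ℝ
    im : ℝ

open ℂ public

ℂ-rawRing : RawRing 0ℓ 0ℓ
ℂ-rawRing = record
  { Carrier = ℂ
  ; _≈_     = λ z w → (re z ≈ℝ re w) × (im z ≈ℝ im w)
  ; _+_     = λ z w → (re z +ℝ re w) +i (im z +ℝ im w)
  ; _*_     = λ z w → (re z *ℝ re w +ℝ -ℝ (im z *ℝ im w)) +i (re z *ℝ im w +ℝ im z *ℝ re w)
  ; -_      = λ z → (-ℝ re z) +i (-ℝ im z)
  ; 0#      = ℚ⇒ℝ 0ℚ +i ℚ⇒ℝ 0ℚ
  ; 1#      = ℚ⇒ℝ 1ℚ +i ℚ⇒ℝ 0ℚ
  }

module ℂR = RawRing ℂ-rawRing
module ℂΣ = RawMonoidOps ℂR.+-rawMonoid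

infix 4 _≈ℂ_
_≈ℂ_ : ℂ → ℂ → Set
_≈ℂ_ = ℂR._≈_

0ℂ : ℂ
0ℂ = ℂR.0#

record ℕ⁺ : Set where
  constructor mkℕ⁺
  field
    val             : ℕ
    {{val-nonZero}} : ℕ.NonZero val

open ℕ⁺ public

suc⁺ : ℕ → ℕ⁺
suc⁺ n = mkℕ⁺ (suc n)

Finite : (ℕ⁺ → Set) → Set
Finite S = ∃[ xs ] ∀ n → S n → n Mem.∈ xs

Infinite : (ℕ⁺ → Set) → Set
Infinite S = ¬ Finite S

support : (ℕ⁺ → ℂ) → ℕ⁺ → Set
support f n = ¬ (f n ≈ℂ 0ℂ)

∑₁ : (N : ℕ) → (ℕ⁺ → ℂ) → ℂ
∑₁ N h = ℂΣ.sum {N} (λ i → h (suc⁺ (toℕ i)))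

-- s is the sum of h d k over all d and k, where h vanishes outside a finite square.
IsSum : (ℕ⁺ → ℕ⁺ → ℂ) → ℂ → Set
IsSum h s = ∃[ N ]
    (∀ d k → N ℕ.< val d ⊎ N ℕ.< val k → h d k ≈ℂ 0ℂ)
  × s ≈ℂ ∑₁ N (λ d → ∑₁ N (λ k → h d k))

module _ (P : Poset c ℓ₁ ℓ₂) where

  open Poset P
  open SetoidMem Eq.setoid using (_∈_)

  record LocallyFinite : Set (c l⊔ ℓ₁ l⊔ ℓ₂) where
    field
      interval         : Carrier → Carrier → List Carrier
      interval-unique  : ∀ x y → SetoidUnique.Unique Eq.setoid (interval x y)
      interval-members : ∀ x y z → z ∈ interval x y ⇔ (x ≤ z × z ≤ y)

  DependsOnlyOn : (Carrier → Carrier → ℕ) → (Carrier → Carrier → ℂ) → Set c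
  DependsOnlyOn t f = ∀ x y x′ y′ → t x y ≡ t x′ y′ → f x y ≈ℂ f x′ y′

  convolution : LocallyFinite → (f₁ f₂ : Carrier → Carrier → ℂ) → Carrier → Carrier → ℂ
  convolution lf f₁ f₂ x y =
    foldr ℂR._+_ 0ℂ (map (λ z → f₁ x z ℂR.* f₂ z y) (LocallyFinite.interval lf x y))

  record SurjectiveTyping : Set (c l⊔ ℓ₁ l⊔ ℓ₂) where
    field
      locallyFinite : LocallyFinite
      type          : Carrier → Carrier → ℕ
      type-cong     : ∀ {x x′ y y′} → x ≈ x′ → y ≈ y′ → type x y ≡ type x′ y′
      type≢0⇔≤      : ∀ x y → type x y ≢ 0 ⇔ x ≤ y
      convolution-closed : ∀ f₁ f₂ → DependsOnlyOn type f₁ → DependsOnlyOn type f₂ →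
        DependsOnlyOn type (convolution locallyFinite f₁ f₂)
      surjective    : ∀ (n : ℕ⁺) → ∃[ x ] ∃[ y ] type x y ≡ val n

    open LocallyFinite locallyFinite public

    -- Counted in the interval of type n supplied by surjectivity; by
    -- convolution-closed (applied to indicator functions) every other
    -- interval of type n gives the same number.
    bracket : ℕ⁺ → ℕ⁺ → ℕ⁺ → ℕ
    bracket n d k with surjective n
    ... | x , y , _ = length
      (filter (λ z → (type x z ℕ.≟ val d) ×-dec (type z y ℕ.≟ val k)) (interval x y))

-- The conclusion "at least one support is infinite" is the classical
-- disjunction, hence the double negation.
PropertyR : {P : Poset c ℓ₁ ℓ₂} → SurjectiveTyping P → Set
PropertyR T = ∀ (f g : ℕ⁺ → ℂ) →
  ¬ (∀ n → f n ≈ℂ 0ℂ) →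
  ¬ (∀ n → g n ≈ℂ 0ℂ) →
  (∀ n → IsSum (λ d k → bracket n d k ℂΣ.× f k) (g n)) →
  ¬ ¬ (Infinite (support f) ⊎ Infinite (support g))
  where open SurjectiveTyping T

ℕ⁺-divisibility : Poset 0ℓ 0ℓ 0ℓ
ℕ⁺-divisibility = On.poset ℕ.∣-poset val

ℕ⁺-usual : Poset 0ℓ 0ℓ 0ℓ
ℕ⁺-usual = On.poset ℕ.≤-poset val

-- A finite subset is a duplicate-free list, two lists being identified
-- when each includes the other.
record FiniteSubset : Set where
  field
    elements : List ℕ⁺
    unique   : Unique elements

  card : ℕ
  card = length elements

open FiniteSubset public using (elements; card)

finiteSubsets : Poset 0ℓ 0ℓ 0ℓ
finiteSubsets = On.poset (Interior.poset {R = _⊆_ {A = ℕ⁺}} ⊆-refl ⊆-trans) elements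

record IsFiniteField (q : ℕ) (R : CommutativeRing c ℓ) : Set (c l⊔ ℓ) where
  open CommutativeRing R
  field
    1≉0     : ¬ (1# ≈ 0#)
    inverse : ∀ x → ¬ (x ≈ 0#) → ∃[ y ] x * y ≈ 1#
    order-q : Inverse (CommutativeRing.setoid R) (≡-setoid (Fin q))

module _ (F : CommutativeRing c ℓ) where

  private module F = CommutativeRing F

  -- F^∞ is the space of finitely supported sequences, of countable dimension.
  record F∞ : Set (c l⊔ ℓ) where
    field
      coord             : ℕ → F.Carrier
      finitelySupported : ∃[ N ] ∀ n → N ℕ.≤ n → coord n F.≈ F.0#

  open F∞

  F∞-rawModule : RawLeftSemimodule F.Carrier (c l⊔ ℓ) ℓ
  F∞-rawModule = record
    { Carrierᴹ = F∞
    ; _≈ᴹ_     = λ v w → ∀ n → coord v n F.≈ coord w n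
    ; _+ᴹ_     = λ v w → record
      { coord = λ n → coord v n F.+ coord w n
      ; finitelySupported =
          let (M , hv) = finitelySupported v
              (N , hw) = finitelySupported w
          in M ⊔ N , λ n n≥ → F.trans
               (F.+-cong (hv n (ℕ.m⊔n≤o⇒m≤o M N n≥)) (hw n (ℕ.m⊔n≤o⇒n≤o M N n≥)))
               (F.+-identityˡ F.0#)
      }
    ; _*ₗ_     = λ a v → record
      { coord = λ n → a F.* coord v n
      ; finitelySupported =
          let (N , hv) = finitelySupported v
          in N , λ n n≥ → F.trans (F.*-congˡ (hv n n≥)) (F.zeroʳ a)
      }
    ; 0ᴹ       = record { coord = λ _ → F.0# ; finitelySupported = 0 , λ _ _ → F.refl }
    }

  open RawLeftSemimodule F∞-rawModule

  linearCombination : ∀ {d} → Vector F.Carrier d → Vector F∞ d → F∞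
  linearCombination a b = RawMonoidOps.sum +ᴹ-rawMonoid (λ i → a i *ₗ b i)

  record FiniteDimSubspace : Set (lsuc (c l⊔ ℓ)) where
    field
      member   : F∞ → Set (c l⊔ ℓ)
      resp     : ∀ {v w} → v ≈ᴹ w → member v → member w
      0-closed : member 0ᴹ
      +-closed : ∀ {v w} → member v → member w → member (v +ᴹ w)
      *-closed : ∀ a {v} → member v → member (a *ₗ v)

      dim         : ℕ
      basis       : Vector F∞ dim
      basis∈      : ∀ i → member (basis i)
      spanning    : ∀ {v} → member v → ∃[ a ] v ≈ᴹ linearCombination a basis
      independent : ∀ a → linearCombination a basis ≈ᴹ 0ᴹ → ∀ i → a i F.≈ F.0#

  open FiniteDimSubspace

  _⊑_ : FiniteDimSubspace → FiniteDimSubspace → Set (c l⊔ ℓ)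
  U ⊑ V = ∀ {v} → member U v → member V v

  finiteDimSubspaces : Poset (lsuc (c l⊔ ℓ)) (c l⊔ ℓ) (c l⊔ ℓ)
  finiteDimSubspaces = Interior.poset {R = _⊑_} (λ u → u) (λ p q u → q (p u))

open FiniteDimSubspace public using (dim)

{-# OPTIONS --safe #-}
module Submission where

-- Intervals of type n + 1 in (ii), (iii), (iv) are enumerated by the reduced row echelon forms
-- of width n over a set of q elements, with q = 1, q = |F|, q = 0 respectively. With all
-- indices shifted to start at 0, ζ * f becomes a sum over echelon forms, whence the recursion
--   g(n+1) − g(n) = Σ_k q^k [n,k] f(n−k+1).
-- For q ≥ 1, if f and g vanish eventually then so does the sum analogous to g for
-- f′(j) = q^(N−j) f(j+1), whose support is shorter; induction on the support gives f = 0.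
-- For q = 0 the recursion reads g(n+1) − g(n) = f(n+1), and f = δ₀ − δ₁ has g = δ₀.
-- In (i), let f and g vanish above N. All divisors e ≤ N of (N! + 1) n divide n, so
-- 0 = g((N! + 1) n) = f(n) + (terms f(e) with e < n), and f = 0 by strong induction.

open import Defs
open import Algebra.Bundles using (CommutativeMonoid; CommutativeRing)
open import Algebra.Module.Bundles using (LeftSemimodule)
open import Algebra.Module.Bundles.Raw using (RawLeftSemimodule)
import Algebra.Properties.CommutativeMonoid.Mult as CommutativeMonoidMult
import Algebra.Properties.CommutativeMonoid.Sum as CommutativeMonoidSum
import Algebra.Properties.CommutativeSemigroup as CommutativeSemigroupProperties
import Algebra.Properties.Monoid.Mult as MonoidMult
open import Data.Bool.Base using (true; false; if_then_else_)
open import Data.Fin.Base as Fin using (Fin; zero; suc; toℕ; fromℕ<; finToFun; funToFin; combine)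
import Data.Fin.Properties as Fin
open import Data.List.Base
  using (List; []; _∷_; _++_; map; foldr; filter; length; concatMap; allFin; cartesianProductWith; upTo)
open import Data.List.Membership.DecPropositional using () renaming (_∈?_ to mk∈?)
import Data.List.Membership.Propositional as Mem
open import Data.List.Membership.Propositional.Properties
  using (∈-map⁺; ∈-map⁻; ∈-++⁺ˡ; ∈-++⁺ʳ; ∈-++⁻; ∈-concatMap⁺; ∈-concatMap⁻; ∈-allFin;
         ∈-cartesianProductWith⁺; ∈-filter⁺; ∈-filter⁻; ∈-upTo⁺)
open import Data.List.Membership.Propositional.Properties.WithK using (unique∧set⇒bag)
import Data.List.Membership.Setoid as SetoidMem
import Data.List.Membership.Setoid.Properties as SetoidMem
open import Data.List.Properties
  using (∷-injective; filter-accept; filter-reject; length-++; length-map; length-tabulate; length-upTo;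
         map-∘; map-cong; map-cong-local)
open import Data.List.Relation.Binary.BagAndSetEquality using (∼bag⇒↭)
open import Data.List.Relation.Binary.Permutation.Propositional.Properties using (↭-length)
import Data.List.Relation.Binary.Subset.DecPropositional as DecSubset
import Data.List.Relation.Binary.Subset.Propositional as Subset
open import Data.List.Relation.Unary.All as All using (All; []; _∷_)
import Data.List.Relation.Unary.All.Properties as All
open import Data.List.Relation.Unary.AllPairs as AllPairs using ([]; _∷_)
import Data.List.Relation.Unary.AllPairs.Properties as AllPairs
open import Data.List.Relation.Unary.Any using (here; there)
open import Data.List.Relation.Unary.Unique.Propositional using (Unique)
import Data.List.Relation.Unary.Unique.Propositional.Properties as Unique
import Data.List.Relation.Unary.Unique.Setoid as SetoidUnique
import Data.List.Relation.Unary.Unique.Setoid.Properties as SetoidUnique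
open import Data.Nat.Base as ℕ
  using (ℕ; zero; suc; pred; _⊔_; NonZero; _*_; _∸_; _^_; _/_; _!; z≤n; s≤s)
open import Data.Nat.Coprimality using (Coprime; coprime-divisor)
open import Data.Nat.Divisibility using (_∣_; _∣?_; divides)
import Data.Nat.Divisibility as ℕ
import Data.Nat.DivMod as ℕ
open import Data.Nat.Induction using (<-rec)
import Data.Nat.Properties as ℕ
open import Data.Product.Base using (∃; ∃-syntax; Σ-syntax; _×_; _,_; proj₁; proj₂)
open import Data.Rational.Base as ℚ using (ℚ; 0ℚ; 1ℚ; ½; positive; 1/_)
import Data.Rational.Properties as ℚ
open import Data.Rational.Solver using (module +-*-Solver)
open import Data.Sum.Base using (_⊎_; inj₁; inj₂; [_,_]′)
open import Data.Vec.Base as Vec using (Vec; []; _∷_; lookup; tabulate)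
open import Data.Vec.Functional as Vector using (Vector)
open import Data.Vec.Properties using (lookup∘tabulate; tabulate∘lookup; tabulate-cong)
  renaming (∷-injective to ∷ᵥ-injective)
open import Function.Base using (_∘_; case_of_)
open import Function.Bundles using (_⇔_; Equivalence; Inverse; mk⇔)
open import Level using (Level; 0ℓ; Lift; lift) renaming (_⊔_ to _l⊔_)
open import Relation.Binary.Bundles using (Poset)
open import Relation.Binary.Construct.Interior.Symmetric using (lhs≤rhs; rhs≤lhs)
open import Relation.Binary.Definitions using (DecidableEquality)
open import Relation.Binary.PropositionalEquality
  using (_≡_; _≢_; refl; sym; trans; cong; cong₂; subst; subst₂; module ≡-Reasoning)
open import Relation.Binary.PropositionalEquality.Properties using () renaming (setoid to ≡-setoid)
import Relation.Binary.Reasoning.Setoid as SetoidReasoning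
open import Relation.Nullary using (¬_; Dec; does; yes; no; contradiction)
open import Relation.Nullary.Decidable using (_×-dec_; map′; dec-true; dec-false; ¬?)
open import Relation.Unary using (Decidable)

-- The coefficients of ζ are never computed. For each type one list of pairs (type below, type
-- above) is exhibited that every interval of this type realises entry by entry. This gives both the
-- closure of convolutions and ζ * f as a sum over the list. Echelon forms supply the list for three
-- posets at once; their recursion is the q-Pascal rule, which survives at q = 0 with 0^0 = 1. The
-- factor in f′ comes from q^k = q^n q^(-j), where j = n - k: up to q^n, the increment of g is the
-- sum of q^(-j) f(j+1). Multiplying by q^N keeps the coefficients integral, because only j ≤ N
-- matters. The arguments thus use only addition and the cancellation of positive multiples, and are
-- carried out in commutative monoids. Two obstacles are constructive. A finite support yields only
-- that f n ≈ 0 cannot fail outside a list, so equality in ℂ has to be stable under double negation.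
-- And `IsSum` supplies a square outside which the products of bracket and f vanish, a square that
-- may miss pairs of the list; there f itself vanishes because ℂ is torsion free.

private variable
  a b c ℓ ℓ₁ ℓ₂ p : Level
  A : Set a
  B : Set b
  n k : ℕ

-- Real numbers: congruence and stability of equality.

module Reals where

  open import Data.Rational.Base using (∣_∣)

  *-pos : ∀ {p q} → 0ℚ ℚ.< p → 0ℚ ℚ.< q → 0ℚ ℚ.< p ℚ.* q
  *-pos {p} {q} p>0 q>0 = ℚ.positive⁻¹ (p ℚ.* q) {{ℚ.pos*pos⇒pos p {{positive p>0}} q {{positive q>0}}}}

  0<½ : 0ℚ ℚ.< ½
  0<½ = ℚ.positive⁻¹ ½

  halves : ∀ ε → ½ ℚ.* ε ℚ.+ ½ ℚ.* ε ≡ ε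
  halves ε = trans (sym (ℚ.*-distribʳ-+ ε ½ ½)) (ℚ.*-identityˡ ε)

  ∣p-q∣-sym : ∀ p q → ∣ p ℚ.- q ∣ ≡ ∣ q ℚ.- p ∣
  ∣p-q∣-sym p q = trans (sym (ℚ.∣-p∣≡∣p∣ (p ℚ.- q))) (cong ∣_∣
    (solve 2 (λ p q → :- (p :+ :- q) := q :+ :- p) refl p q))
    where
    open +-*-Solver

  triangle : ∀ p q r {ε} → ∣ p ℚ.- q ∣ ℚ.< ½ ℚ.* ε → ∣ q ℚ.- r ∣ ℚ.< ½ ℚ.* ε → ∣ p ℚ.- r ∣ ℚ.< ε
  triangle p q r {ε} h₁ h₂ = begin-strict
    ∣ p ℚ.- r ∣                        ≡⟨ cong ∣_∣ (solve 3 (λ p q r → p :+ :- r := (p :+ :- q) :+ (q :+ :- r)) refl p q r) ⟩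
    ∣ (p ℚ.- q) ℚ.+ (q ℚ.- r) ∣        ≤⟨ ℚ.∣p+q∣≤∣p∣+∣q∣ (p ℚ.- q) (q ℚ.- r) ⟩
    ∣ p ℚ.- q ∣ ℚ.+ ∣ q ℚ.- r ∣        <⟨ ℚ.+-mono-< h₁ h₂ ⟩
    ½ ℚ.* ε ℚ.+ ½ ℚ.* ε                ≡⟨ halves ε ⟩
    ε                                  ∎
    where
    open ℚ.≤-Reasoning
    open +-*-Solver

  pointwise : ∀ {x y} → (∀ n → seq x n ≡ seq y n) → x ≈ℝ y
  pointwise {x} {y} eq ε ε>0 = 0 , λ n _ → subst (ℚ._< ε)
    (sym (cong ∣_∣ (trans (cong (ℚ._- seq y n) (eq n)) (ℚ.+-inverseʳ (seq y n))))) ε>0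

  ≈-refl : ∀ {x} → x ≈ℝ x
  ≈-refl {x} = pointwise {x} {x} (λ _ → refl)

  ≈-sym : ∀ {x y} → x ≈ℝ y → y ≈ℝ x
  ≈-sym {x} {y} x≈y ε ε>0 with N , h ← x≈y ε ε>0 =
    N , λ n N≤n → subst (ℚ._< ε) (∣p-q∣-sym (seq x n) (seq y n)) (h n N≤n)

  ≈-trans : ∀ {x y z} → x ≈ℝ y → y ≈ℝ z → x ≈ℝ z
  ≈-trans {x} {y} {z} x≈y y≈z ε ε>0
    with M , h₁ ← x≈y (½ ℚ.* ε) (*-pos 0<½ ε>0)
       | N , h₂ ← y≈z (½ ℚ.* ε) (*-pos 0<½ ε>0)
    = M ⊔ N , λ n n≥ → triangle (seq x n) (seq y n) (seq z n)
        (h₁ n (ℕ.m⊔n≤o⇒m≤o M N n≥)) (h₂ n (ℕ.m⊔n≤o⇒n≤o M N n≥))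

  +-cong : ∀ {x x′ y y′} → x ≈ℝ x′ → y ≈ℝ y′ → (x +ℝ y) ≈ℝ (x′ +ℝ y′)
  +-cong {x} {x′} {y} {y′} x≈ y≈ ε ε>0
    with M , h₁ ← x≈ (½ ℚ.* ε) (*-pos 0<½ ε>0)
       | N , h₂ ← y≈ (½ ℚ.* ε) (*-pos 0<½ ε>0)
    = M ⊔ N , λ n n≥ → triangle (seq x n ℚ.+ seq y n) (seq x′ n ℚ.+ seq y n) (seq x′ n ℚ.+ seq y′ n)
        (subst (ℚ._< _) (cong ∣_∣ (cancelʳ (seq x n) (seq x′ n) (seq y n))) (h₁ n (ℕ.m⊔n≤o⇒m≤o M N n≥)))
        (subst (ℚ._< _) (cong ∣_∣ (cancelˡ (seq y n) (seq y′ n) (seq x′ n))) (h₂ n (ℕ.m⊔n≤o⇒n≤o M N n≥)))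
    where
    open +-*-Solver
    cancelʳ : ∀ a a′ b → a ℚ.- a′ ≡ (a ℚ.+ b) ℚ.- (a′ ℚ.+ b)
    cancelʳ = solve 3 (λ a a′ b → a :+ :- a′ := (a :+ b) :+ :- (a′ :+ b)) refl
    cancelˡ : ∀ b b′ a → b ℚ.- b′ ≡ (a ℚ.+ b) ℚ.- (a ℚ.+ b′)
    cancelˡ = solve 3 (λ b b′ a → b :+ :- b′ := (a :+ b) :+ :- (a :+ b′)) refl

  neg-cong : ∀ {x y} → x ≈ℝ y → (-ℝ x) ≈ℝ (-ℝ y)
  neg-cong {x} {y} x≈y ε ε>0 with N , h ← x≈y ε ε>0 =
    N , λ n N≤n → subst (ℚ._< ε)
      (trans (∣p-q∣-sym (seq x n) (seq y n)) (cong ∣_∣ (swap (seq x n) (seq y n)))) (h n N≤n)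
    where
    open +-*-Solver
    swap : ∀ p q → q ℚ.- p ≡ ℚ.- p ℚ.- ℚ.- q
    swap = solve 2 (λ p q → q :+ :- p := :- p :+ :- (:- q)) refl

  eventually-bounded : ∀ x → ∃[ B ] 0ℚ ℚ.< B × ∃[ N ] ∀ n → N ℕ.≤ n → ∣ seq x n ∣ ℚ.≤ B
  eventually-bounded x with N , h ← cauchy x 1ℚ (ℚ.positive⁻¹ 1ℚ) =
    1ℚ ℚ.+ ∣ seq x N ∣ , ℚ.+-mono-<-≤ (ℚ.positive⁻¹ 1ℚ) (ℚ.0≤∣p∣ (seq x N)) , N , λ n N≤n → begin
      ∣ seq x n ∣                              ≡⟨ cong ∣_∣ (split (seq x n) (seq x N)) ⟩
      ∣ (seq x n ℚ.- seq x N) ℚ.+ seq x N ∣     ≤⟨ ℚ.∣p+q∣≤∣p∣+∣q∣ (seq x n ℚ.- seq x N) (seq x N) ⟩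
      ∣ seq x n ℚ.- seq x N ∣ ℚ.+ ∣ seq x N ∣   ≤⟨ ℚ.+-monoˡ-≤ ∣ seq x N ∣ (ℚ.<⇒≤ (h n N N≤n ℕ.≤-refl)) ⟩
      1ℚ ℚ.+ ∣ seq x N ∣                       ∎
    where
    open ℚ.≤-Reasoning
    split : ∀ a b → a ≡ (a ℚ.- b) ℚ.+ b
    split = let open +-*-Solver in solve 2 (λ a b → a := (a :+ :- b) :+ b) refl

  *-comm : ∀ x y → (x *ℝ y) ≈ℝ (y *ℝ x)
  *-comm x y = pointwise {x *ℝ y} {y *ℝ x} (λ n → ℚ.*-comm (seq x n) (seq y n))

  divide : ∀ B ε → 0ℚ ℚ.< B → 0ℚ ℚ.< ε → ∃[ δ ] 0ℚ ℚ.< δ × B ℚ.* δ ≡ ε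
  divide B ε B>0 ε>0 = B⁻¹ ℚ.* ε , *-pos (ℚ.positive⁻¹ B⁻¹ {{ℚ.1/pos⇒pos B {{positive B>0}}}}) ε>0 , (begin
    B ℚ.* (B⁻¹ ℚ.* ε)  ≡⟨ ℚ.*-assoc B B⁻¹ ε ⟨
    B ℚ.* B⁻¹ ℚ.* ε    ≡⟨ cong (ℚ._* ε) (ℚ.*-inverseʳ B {{ℚ.pos⇒nonZero B {{positive B>0}}}}) ⟩
    1ℚ ℚ.* ε           ≡⟨ ℚ.*-identityˡ ε ⟩
    ε                  ∎)
    where
    open ≡-Reasoning
    B⁻¹ : ℚ
    B⁻¹ = (1/ B) {{ℚ.pos⇒nonZero B {{positive B>0}}}}

  product-bound : ∀ {B δ} p d → 0ℚ ℚ.< B → ∣ p ∣ ℚ.≤ B → ∣ d ∣ ℚ.< δ → ∣ p ℚ.* d ∣ ℚ.< B ℚ.* δ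
  product-bound {B} {δ} p d B>0 ∣p∣≤B ∣d∣<δ = begin-strict
    ∣ p ℚ.* d ∣      ≡⟨ ℚ.∣p*q∣≡∣p∣*∣q∣ p d ⟩
    ∣ p ∣ ℚ.* ∣ d ∣  ≤⟨ ℚ.*-monoʳ-≤-nonNeg ∣ d ∣ {{ℚ.nonNegative (ℚ.0≤∣p∣ d)}} ∣p∣≤B ⟩
    B ℚ.* ∣ d ∣      <⟨ ℚ.*-monoʳ-<-pos B {{positive B>0}} ∣d∣<δ ⟩
    B ℚ.* δ          ∎
    where
    open ℚ.≤-Reasoning

  *-congˡ : ∀ x {y y′} → y ≈ℝ y′ → (x *ℝ y) ≈ℝ (x *ℝ y′)
  *-congˡ x {y} {y′} y≈ ε ε>0 =
    let B , B>0 , M , bound = eventually-bounded x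
        δ , δ>0 , B*δ≡ε = divide B ε B>0 ε>0
        N , near = y≈ δ δ>0
    in M ⊔ N , λ n n≥ → subst₂ ℚ._<_ (cong ∣_∣ (factor (seq x n) (seq y n) (seq y′ n))) B*δ≡ε
         (product-bound (seq x n) (seq y n ℚ.- seq y′ n) B>0
           (bound n (ℕ.m⊔n≤o⇒m≤o M N n≥)) (near n (ℕ.m⊔n≤o⇒n≤o M N n≥)))
    where
    factor : ∀ a b b′ → a ℚ.* (b ℚ.- b′) ≡ a ℚ.* b ℚ.- a ℚ.* b′
    factor a b b′ = trans (ℚ.*-distribˡ-+ a b (ℚ.- b′)) (cong (a ℚ.* b ℚ.+_) (sym (ℚ.neg-distribʳ-* a b′)))

  *-cong : ∀ {x x′ y y′} → x ≈ℝ x′ → y ≈ℝ y′ → (x *ℝ y) ≈ℝ (x′ *ℝ y′)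
  *-cong {x} {x′} {y} {y′} x≈ y≈ =
    ≈-trans {x *ℝ y} {x *ℝ y′} {x′ *ℝ y′} (*-congˡ x {y} {y′} y≈)
      (≈-trans {x *ℝ y′} {y′ *ℝ x} {x′ *ℝ y′} (*-comm x y′)
        (≈-trans {y′ *ℝ x} {y′ *ℝ x′} {x′ *ℝ y′} (*-congˡ y′ {x} {x′} x≈) (*-comm y′ x′)))

  ¼_ : ℚ → ℚ
  ¼ ε = ½ ℚ.* (½ ℚ.* ε)

  ¼-pos : ∀ {ε} → 0ℚ ℚ.< ε → 0ℚ ℚ.< ¼ ε
  ¼-pos ε>0 = *-pos 0<½ (*-pos 0<½ ε>0)

  ½*-< : ∀ {ε} → 0ℚ ℚ.< ε → ½ ℚ.* ε ℚ.< ε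
  ½*-< {ε} ε>0 = begin-strict
    ½ ℚ.* ε               ≡⟨ ℚ.+-identityʳ (½ ℚ.* ε) ⟨
    ½ ℚ.* ε ℚ.+ 0ℚ        <⟨ ℚ.+-monoʳ-< (½ ℚ.* ε) (*-pos 0<½ ε>0) ⟩
    ½ ℚ.* ε ℚ.+ ½ ℚ.* ε   ≡⟨ halves ε ⟩
    ε                     ∎
    where
    open ℚ.≤-Reasoning

  ¼-< : ∀ {ε} → 0ℚ ℚ.< ε → ¼ ε ℚ.< ε
  ¼-< ε>0 = ℚ.<-trans (½*-< (*-pos 0<½ ε>0)) (½*-< ε>0)

  triangle₃ : ∀ p q r s {ε} → 0ℚ ℚ.< ε →
    ∣ p ℚ.- q ∣ ℚ.< ¼ ε → ∣ q ℚ.- r ∣ ℚ.< ¼ ε → ∣ r ℚ.- s ∣ ℚ.< ¼ ε → ∣ p ℚ.- s ∣ ℚ.< ε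
  triangle₃ p q r s ε>0 h₁ h₂ h₃ =
    triangle p q s (ℚ.<-trans h₁ (½*-< (*-pos 0<½ ε>0))) (triangle q r s h₂ h₃)

  -- The Cauchy moduli reduce x ≈ y up to ε to one decidable comparison of rationals.
  ≈-stable : ∀ {x y} → ¬ ¬ (x ≈ℝ y) → x ≈ℝ y
  ≈-stable {x} {y} ¬¬x≈y ε ε>0 =
    let M , hx = cauchy x (¼ ¼ ε) (¼-pos (¼-pos ε>0))
        N , hy = cauchy y (¼ ¼ ε) (¼-pos (¼-pos ε>0))
    in compare (M ⊔ N)
      (λ m n m≥ n≥ → hx m n (ℕ.m⊔n≤o⇒m≤o M N m≥) (ℕ.m⊔n≤o⇒m≤o M N n≥))
      (λ m n m≥ n≥ → hy m n (ℕ.m⊔n≤o⇒n≤o M N m≥) (ℕ.m⊔n≤o⇒n≤o M N n≥))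
    where
    compare : ∀ L →
      (∀ m n → L ℕ.≤ m → L ℕ.≤ n → ∣ seq x m ℚ.- seq x n ∣ ℚ.< ¼ ¼ ε) →
      (∀ m n → L ℕ.≤ m → L ℕ.≤ n → ∣ seq y m ℚ.- seq y n ∣ ℚ.< ¼ ¼ ε) →
      ∃[ N ] ∀ n → N ℕ.≤ n → ∣ seq x n ℚ.- seq y n ∣ ℚ.< ε
    compare L hx hy with ∣ seq x L ℚ.- seq y L ∣ ℚ.<? ¼ ε
    ... | yes near = L , λ n L≤n → triangle₃ (seq x n) (seq x L) (seq y L) (seq y n) ε>0
            (ℚ.<-trans (hx n L L≤n ℕ.≤-refl) (¼-< (¼-pos ε>0)))
            near
            (ℚ.<-trans (hy L n ℕ.≤-refl L≤n) (¼-< (¼-pos ε>0)))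
    ... | no far = contradiction (λ (x≈y : x ≈ℝ y) →
            let K , h = x≈y (¼ ¼ ε) (¼-pos (¼-pos ε>0))
                n = K ⊔ L
                L≤n = ℕ.m≤n⊔m K L
            in far (triangle₃ (seq x L) (seq x n) (seq y n) (seq y L) (¼-pos ε>0)
                 (hx L n ℕ.≤-refl L≤n) (h n (ℕ.m≤m⊔n K L)) (hy n L L≤n ℕ.≤-refl)))
            ¬¬x≈y

-- The additive monoid of complex numbers and its torsion-freeness.

ℂ-+-commutativeMonoid : CommutativeMonoid 0ℓ 0ℓ
ℂ-+-commutativeMonoid = record
  { Carrier = ℂ
  ; _≈_     = _≈ℂ_
  ; _∙_     = ℂR._+_
  ; ε       = 0ℂ
  ; isCommutativeMonoid = record
    { isMonoid = record
      { isSemigroup = record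
        { isMagma = record
          { isEquivalence = record
            { refl  = λ {z} → Reals.≈-refl {re z} , Reals.≈-refl {im z}
            ; sym   = λ {z} {w} (r , i) → Reals.≈-sym {re z} {re w} r , Reals.≈-sym {im z} {im w} i
            ; trans = λ {z} {w} {u} (r , i) (r′ , i′) →
                Reals.≈-trans {re z} {re w} {re u} r r′ , Reals.≈-trans {im z} {im w} {im u} i i′
            }
          ; ∙-cong = λ {z} {z′} {w} {w′} (r , i) (r′ , i′) →
              Reals.+-cong {re z} {re z′} {re w} {re w′} r r′ , Reals.+-cong {im z} {im z′} {im w} {im w′} i i′
          }
        ; assoc = λ z w u → pointwiseℂ (z ℂR.+ w ℂR.+ u) (z ℂR.+ (w ℂR.+ u))
            (λ n → ℚ.+-assoc (seq (re z) n) (seq (re w) n) (seq (re u) n))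
            (λ n → ℚ.+-assoc (seq (im z) n) (seq (im w) n) (seq (im u) n))
        }
      ; identity =
          (λ z → pointwiseℂ (0ℂ ℂR.+ z) z (λ n → ℚ.+-identityˡ (seq (re z) n)) (λ n → ℚ.+-identityˡ (seq (im z) n)))
        , (λ z → pointwiseℂ (z ℂR.+ 0ℂ) z (λ n → ℚ.+-identityʳ (seq (re z) n)) (λ n → ℚ.+-identityʳ (seq (im z) n)))
      }
    ; comm = λ z w → pointwiseℂ (z ℂR.+ w) (w ℂR.+ z)
        (λ n → ℚ.+-comm (seq (re z) n) (seq (re w) n)) (λ n → ℚ.+-comm (seq (im z) n) (seq (im w) n))
    }
  }
  where
  pointwiseℂ : ∀ z w → (∀ n → seq (re z) n ≡ seq (re w) n) → (∀ n → seq (im z) n ≡ seq (im w) n) → z ≈ℂ w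
  pointwiseℂ z w r i = Reals.pointwise {re z} {re w} r , Reals.pointwise {im z} {im w} i

ℂ-*-cong : ∀ {z z′ w w′} → z ≈ℂ z′ → w ≈ℂ w′ → (z ℂR.* w) ≈ℂ (z′ ℂR.* w′)
ℂ-*-cong {a +i b} {a′ +i b′} {c +i d} {c′ +i d′} (a≈ , b≈) (c≈ , d≈) =
    Reals.+-cong {a *ℝ c} {a′ *ℝ c′} { -ℝ (b *ℝ d)} { -ℝ (b′ *ℝ d′)} (Reals.*-cong {a} {a′} {c} {c′} a≈ c≈)
      (Reals.neg-cong {b *ℝ d} {b′ *ℝ d′} (Reals.*-cong {b} {b′} {d} {d′} b≈ d≈))
  , Reals.+-cong {a *ℝ d} {a′ *ℝ d′} {b *ℝ c} {b′ *ℝ c′} (Reals.*-cong {a} {a′} {d} {d′} a≈ d≈)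
      (Reals.*-cong {b} {b′} {c} {c′} b≈ c≈)

ℂ-≈-stable : ∀ {z w} → ¬ ¬ (z ≈ℂ w) → z ≈ℂ w
ℂ-≈-stable {z} {w} ¬¬z≈w =
    Reals.≈-stable {re z} {re w} (λ ¬r → ¬¬z≈w (λ z≈w → ¬r (proj₁ z≈w)))
  , Reals.≈-stable {im z} {im w} (λ ¬i → ¬¬z≈w (λ z≈w → ¬i (proj₂ z≈w)))

module _ where
  open import Data.Rational.Base using (∣_∣)
  open MonoidMult ℚ.+-0-monoid using () renaming (_×_ to _·_)

  ∣p∣≤∣n×p∣ : ∀ n p → ∣ p ∣ ℚ.≤ ∣ suc n · p ∣
  ∣p∣≤∣n×p∣ n p = begin
    ∣ p ∣                        ≡⟨ ℚ.*-identityˡ ∣ p ∣ ⟨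
    1ℚ ℚ.* ∣ p ∣                 ≤⟨ ℚ.*-monoʳ-≤-nonNeg ∣ p ∣ {{ℚ.nonNegative (ℚ.0≤∣p∣ p)}} 1≤ ⟩
    (suc n · 1ℚ) ℚ.* ∣ p ∣       ≡⟨ cong (ℚ._* ∣ p ∣) (ℚ.0≤p⇒∣p∣≡p (ℚ.≤-trans (ℚ.nonNegative⁻¹ 1ℚ) 1≤)) ⟨
    ∣ suc n · 1ℚ ∣ ℚ.* ∣ p ∣     ≡⟨ ℚ.∣p*q∣≡∣p∣*∣q∣ (suc n · 1ℚ) p ⟨
    ∣ (suc n · 1ℚ) ℚ.* p ∣       ≡⟨ cong ∣_∣ (×1* (suc n)) ⟩
    ∣ suc n · p ∣                ∎
    where
    open ℚ.≤-Reasoning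
    0≤×1 : ∀ m → 0ℚ ℚ.≤ m · 1ℚ
    0≤×1 zero    = ℚ.≤-refl
    0≤×1 (suc m) = ℚ.+-mono-≤ (ℚ.nonNegative⁻¹ 1ℚ) (0≤×1 m)
    1≤ : 1ℚ ℚ.≤ suc n · 1ℚ
    1≤ = ℚ.+-monoʳ-≤ 1ℚ (0≤×1 n)
    ×1* : ∀ m → (m · 1ℚ) ℚ.* p ≡ m · p
    ×1* zero    = ℚ.*-zeroˡ p
    ×1* (suc m) = trans (ℚ.*-distribʳ-+ p 1ℚ (m · 1ℚ)) (cong₂ ℚ._+_ (ℚ.*-identityˡ p) (×1* m))

  -- Multiples are formed termwise on the representing sequences, and termwise |p| ≤ |(n+1) p|;
  -- hence a threshold that works for the multiple also works for `z`.
  ℂ-torsion-free : ∀ n {z} → (suc n ℂΣ.× z) ≈ℂ 0ℂ → z ≈ℂ 0ℂ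
  ℂ-torsion-free n {z} (r , i) = below (re z) (re (suc n ℂΣ.× z)) (re-× (suc n)) r
                               , below (im z) (im (suc n ℂΣ.× z)) (im-× (suc n)) i
    where
    re-× : ∀ m k → seq (re (m ℂΣ.× z)) k ≡ m · seq (re z) k
    re-× zero    k = refl
    re-× (suc m) k = cong (seq (re z) k ℚ.+_) (re-× m k)
    im-× : ∀ m k → seq (im (m ℂΣ.× z)) k ≡ m · seq (im z) k
    im-× zero    k = refl
    im-× (suc m) k = cong (seq (im z) k ℚ.+_) (im-× m k)
    ∣p-0∣ : ∀ p → ∣ p ℚ.- 0ℚ ∣ ≡ ∣ p ∣
    ∣p-0∣ p = cong ∣_∣ (ℚ.+-identityʳ p)
    below : ∀ x y → (∀ k → seq y k ≡ suc n · seq x k) → y ≈ℝ ℚ⇒ℝ 0ℚ → x ≈ℝ ℚ⇒ℝ 0ℚ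
    below x y y≡n×x y≈0 ε ε>0 with N , h ← y≈0 ε ε>0 = N , λ k N≤k → begin-strict
      ∣ seq x k ℚ.- 0ℚ ∣    ≡⟨ ∣p-0∣ (seq x k) ⟩
      ∣ seq x k ∣           ≤⟨ ∣p∣≤∣n×p∣ n (seq x k) ⟩
      ∣ suc n · seq x k ∣   ≡⟨ cong ∣_∣ (y≡n×x k) ⟨
      ∣ seq y k ∣           ≡⟨ ∣p-0∣ (seq y k) ⟨
      ∣ seq y k ℚ.- 0ℚ ∣    <⟨ h k N≤k ⟩
      ε                     ∎
      where
      open ℚ.≤-Reasoning

1ℂ≉0ℂ : ¬ (ℂR.1# ≈ℂ 0ℂ)
1ℂ≉0ℂ (1≈0 , _) with N , h ← 1≈0 1ℚ (ℚ.positive⁻¹ 1ℚ) = ℚ.<-irrefl refl (h N ℕ.≤-refl)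

1ℂ-1ℂ≈0ℂ : (ℂR.1# ℂR.+ ℂR.- ℂR.1#) ≈ℂ 0ℂ
1ℂ-1ℂ≈0ℂ = Reals.pointwise {ℚ⇒ℝ 1ℚ +ℝ -ℝ ℚ⇒ℝ 1ℚ} {ℚ⇒ℝ 0ℚ} (λ _ → refl)
         , Reals.pointwise {ℚ⇒ℝ 0ℚ +ℝ -ℝ ℚ⇒ℝ 0ℚ} {ℚ⇒ℝ 0ℚ} (λ _ → refl)

-- Counting pairs of types.

val-injective : ∀ {m n} → val m ≡ val n → m ≡ n
val-injective {mkℕ⁺ (suc _)} {mkℕ⁺ (suc _)} refl = refl

length-filter-map : {P : B → Set p} (P? : Decidable P) (f : A → B) (xs : List A) →
  length (filter (λ x → P? (f x)) xs) ≡ length (filter P? (map f xs))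
length-filter-map P? f []       = refl
length-filter-map P? f (x ∷ xs) with does (P? (f x))
... | true  = cong suc (length-filter-map P? f xs)
... | false = length-filter-map P? f xs

pair≟ : ∀ (d k : ℕ) (p : ℕ × ℕ) → Dec (proj₁ p ≡ d × proj₂ p ≡ k)
pair≟ d k p = (proj₁ p ℕ.≟ d) ×-dec (proj₂ p ℕ.≟ k)

vals : ℕ⁺ × ℕ⁺ → ℕ × ℕ
vals (d , k) = val d , val k

-- Uses the same test as `bracket`, so that the two numbers agree as soon as the underlying lists of
-- pairs do.
count : List (ℕ⁺ × ℕ⁺) → ℕ⁺ → ℕ⁺ → ℕ
count ps d k = length (filter (pair≟ (val d) (val k)) (map vals ps))

vals≟ : ∀ p d k → Dec (vals p ≡ (val d , val k))
vals≟ p d k = map′ (λ (eq₁ , eq₂) → cong₂ _,_ eq₁ eq₂) (λ { refl → refl , refl }) (pair≟ (val d) (val k) (vals p))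

count-≡ : ∀ p ps {d k} → vals p ≡ (val d , val k) → count (p ∷ ps) d k ≡ suc (count ps d k)
count-≡ p ps {d} {k} eq =
  cong (length {A = ℕ × ℕ}) (filter-accept (pair≟ (val d) (val k)) {x = vals p} {xs = map vals ps} (cong proj₁ eq , cong proj₂ eq))

count-≢ : ∀ p ps {d k} → vals p ≢ (val d , val k) → count (p ∷ ps) d k ≡ count ps d k
count-≢ p ps {d} {k} neq =
  cong (length {A = ℕ × ℕ}) (filter-reject (pair≟ (val d) (val k)) {x = vals p} {xs = map vals ps} (λ (eq₁ , eq₂) → neq (cong₂ _,_ eq₁ eq₂)))

count≡0 : ∀ ps {d k} → (∀ {p} → p Mem.∈ ps → vals p ≢ (val d , val k)) → count ps d k ≡ 0
count≡0 []       _ = refl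
count≡0 (p ∷ ps) {d} {k} absent = trans (count-≢ p ps {d} {k} (absent (here refl))) (count≡0 ps {d} {k} (λ q∈ → absent (there q∈)))

count≢0 : ∀ {ps d k} → (d , k) Mem.∈ ps → ∃[ m ] count ps d k ≡ suc m
count≢0 {p ∷ ps} {d} {k} (here refl) = _ , count-≡ p ps {d} {k} refl
count≢0 {p ∷ ps} {d} {k} (there p∈) with vals≟ p d k
... | yes eq = _ , count-≡ p ps {d} {k} eq
... | no neq with m , eq ← count≢0 {ps} {d} {k} p∈ = m , trans (count-≢ p ps {d} {k} neq) eq

-- Sums over lists and over squares in a commutative monoid.

module ListSum (M : CommutativeMonoid c ℓ) where

  open CommutativeMonoid M renaming (_∙_ to _+_; ε to 0#; ∙-cong to +-cong; ∙-congˡ to +-congˡ;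
    ∙-congʳ to +-congʳ; identityˡ to +-identityˡ; identityʳ to +-identityʳ; assoc to +-assoc;
    refl to ≈-refl; sym to ≈-sym; trans to ≈-trans; reflexive to ≈-reflexive) public
  open CommutativeMonoidSum M public using (sum; sum-cong-≋; ∑-distrib-+; sum-replicate-zero)
  open MonoidMult monoid public using (×-congʳ; ×-congˡ; ×-assocˡ; ×-homo-1) renaming (_×_ to _·_)
  open CommutativeMonoidMult M public using (×-distrib-+)
  open SetoidReasoning setoid

  TorsionFree : Set (c l⊔ ℓ)
  TorsionFree = ∀ n {z} → suc n · z ≈ 0# → z ≈ 0#

  ∑ : List A → (A → Carrier) → Carrier
  ∑ xs f = foldr _+_ 0# (map f xs)

  ∑-map : ∀ (g : A → B) xs f → ∑ (map g xs) f ≡ ∑ xs (f ∘ g)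
  ∑-map g []       f = refl
  ∑-map g (x ∷ xs) f = cong (f (g x) +_) (∑-map g xs f)

  ∑-cong : ∀ (xs : List A) {f g} → (∀ {x} → x Mem.∈ xs → f x ≈ g x) → ∑ xs f ≈ ∑ xs g
  ∑-cong []       f≈g = ≈-refl
  ∑-cong (x ∷ xs) f≈g = +-cong (f≈g (here refl)) (∑-cong xs (f≈g ∘ there))

  ∑-zero : ∀ (xs : List A) {f} → (∀ {x} → x Mem.∈ xs → f x ≈ 0#) → ∑ xs f ≈ 0#
  ∑-zero []       f≈0 = ≈-refl
  ∑-zero (x ∷ xs) f≈0 = ≈-trans (+-cong (f≈0 (here refl)) (∑-zero xs (f≈0 ∘ there))) (+-identityˡ 0#)

  ∑-++ : ∀ (xs ys : List A) f → ∑ (xs ++ ys) f ≈ ∑ xs f + ∑ ys f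
  ∑-++ []       ys f = ≈-sym (+-identityˡ _)
  ∑-++ (x ∷ xs) ys f = ≈-trans (+-congˡ (∑-++ xs ys f)) (≈-sym (+-assoc _ _ _))

  ∑-concatMap : ∀ (g : A → List B) xs f → ∑ (concatMap g xs) f ≈ ∑ xs (λ x → ∑ (g x) f)
  ∑-concatMap g []       f = ≈-refl
  ∑-concatMap g (x ∷ xs) f = ≈-trans (∑-++ (g x) (concatMap g xs) f) (+-congˡ (∑-concatMap g xs f))

  ∑-const : ∀ (xs : List A) z → ∑ xs (λ _ → z) ≡ length xs · z
  ∑-const []       z = refl
  ∑-const (x ∷ xs) z = cong (z +_) (∑-const xs z)

  ·-zero : ∀ n → n · 0# ≈ 0#
  ·-zero zero    = ≈-refl
  ·-zero (suc n) = ≈-trans (+-identityˡ _) (·-zero n)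

  ·-∑ : ∀ n (xs : List A) f → n · ∑ xs f ≈ ∑ xs (λ x → n · f x)
  ·-∑ n []       f = ·-zero n
  ·-∑ n (x ∷ xs) f = ≈-trans (×-distrib-+ (f x) (∑ xs f) n) (+-congˡ (·-∑ n xs f))

  ∑-single : ∀ {xs : List A} {x f} → Unique xs → x Mem.∈ xs →
    (∀ {y} → y Mem.∈ xs → y ≢ x → f y ≈ 0#) → ∑ xs f ≈ f x
  ∑-single {xs = x ∷ xs} (x≢ ∷ _) (here refl) f≈0 =
    ≈-trans (+-congˡ (∑-zero xs (λ y∈ → f≈0 (there y∈) (λ y≡x → All.lookup x≢ y∈ (sym y≡x))))) (+-identityʳ _)
  ∑-single {xs = x ∷ xs} (x≢ ∷ u) (there x∈) f≈0 =
    ≈-trans (+-cong (f≈0 (here refl) (All.lookup x≢ x∈)) (∑-single u x∈ (f≈0 ∘ there))) (+-identityˡ _)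

  -- Made for `convolution-closed`: two intervals of one type are compared position by position,
  -- which is why their lists of types are asked to be equal and not merely equal up to order.
  ∑-map-≡ : ∀ {C : Set p} (t : A → C) (t′ : B → C) xs ys {f g} → map t xs ≡ map t′ ys →
    (∀ x y → t x ≡ t′ y → f x ≈ g y) → ∑ xs f ≈ ∑ ys g
  ∑-map-≡ t t′ []       []       _  _   = ≈-refl
  ∑-map-≡ t t′ (x ∷ xs) (y ∷ ys) eq f≈g with eq₁ , eq₂ ← ∷-injective eq =
    +-cong (f≈g x y eq₁) (∑-map-≡ t t′ xs ys eq₂ f≈g)

  sum-zero : ∀ {n} (t : Vector Carrier n) → (∀ i → t i ≈ 0#) → sum t ≈ 0#
  sum-zero {n} t t≈0 = ≈-trans (sum-cong-≋ t≈0) (sum-replicate-zero n)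

  sum-single : ∀ {n} (t : Vector Carrier n) i → (∀ j → j ≢ i → t j ≈ 0#) → sum t ≈ t i
  sum-single t zero    t≈0 = ≈-trans (+-congˡ (sum-zero (t ∘ suc) (λ j → t≈0 (suc j) λ ()))) (+-identityʳ _)
  sum-single t (suc i) t≈0 = ≈-trans
    (+-cong (t≈0 zero λ ()) (sum-single (t ∘ suc) i (λ j j≢i → t≈0 (suc j) (j≢i ∘ Fin.suc-injective))))
    (+-identityˡ _)

  module _ (f : ℕ⁺ → Carrier) (N : ℕ) where

    private
      -- Kronecker delta at the pair `p`, weighted by `f`: the contribution of the single list entry
      -- `p` to the sum over the square.
      δ : ℕ⁺ × ℕ⁺ → ℕ⁺ → ℕ⁺ → Carrier
      δ p d k = if does (vals≟ p d k) then f k else 0#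

      δ-≡ : ∀ p d k → vals p ≡ (val d , val k) → δ p d k ≡ f k
      δ-≡ p d k eq = cong (if_then f k else 0#) (dec-true (vals≟ p d k) eq)

      δ-≢ : ∀ p d k → vals p ≢ (val d , val k) → δ p d k ≡ 0#
      δ-≢ p d k neq = cong (if_then f k else 0#) (dec-false (vals≟ p d k) neq)

      δ-zero : ∀ p d k → f (proj₂ p) ≈ 0# → δ p d k ≈ 0#
      δ-zero p d k f≈0 = case vals≟ p d k of λ where
        (yes eq) → ≈-trans (≈-reflexive (trans (δ-≡ p d k eq) (cong f (val-injective (sym (cong proj₂ eq)))))) f≈0
        (no neq) → ≈-reflexive (δ-≢ p d k neq)

      index : ∀ n → val n ℕ.≤ N → ∃[ i ] suc⁺ (toℕ {N} i) ≡ n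
      index (mkℕ⁺ (suc n)) n<N = fromℕ< n<N , cong suc⁺ (Fin.toℕ-fromℕ< n<N)

      ∑∑ : (ℕ⁺ → ℕ⁺ → Carrier) → Carrier
      ∑∑ h = sum {N} (λ i → sum {N} (λ j → h (suc⁺ (toℕ i)) (suc⁺ (toℕ j))))

      -- An entry outside the square is tolerated if `f` vanishes at it, since the square of a given
      -- double sum is only known to contain the nonzero products.
      ∑∑δ : ∀ p → (val (proj₁ p) ℕ.≤ N × val (proj₂ p) ℕ.≤ N) ⊎ f (proj₂ p) ≈ 0# → ∑∑ (δ p) ≈ f (proj₂ p)
      ∑∑δ p (inj₂ f≈0) = ≈-trans (sum-zero {N} _ (λ i → sum-zero {N} _ (λ j → δ-zero p _ _ f≈0))) (≈-sym f≈0)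
      ∑∑δ p@(d , k) (inj₁ (d≤N , k≤N)) with index d d≤N | index k k≤N
      ... | i , refl | j , refl = begin
        ∑∑ (δ p)                                            ≈⟨ sum-single {N} _ i (λ i′ i′≢i → sum-zero {N} _ (λ j′ →
          ≈-reflexive (δ-≢ p (suc⁺ (toℕ i′)) (suc⁺ (toℕ j′)) (λ eq →
            i′≢i (Fin.toℕ-injective (ℕ.suc-injective (sym (cong proj₁ eq)))))))) ⟩
        sum {N} (λ j′ → δ p (suc⁺ (toℕ i)) (suc⁺ (toℕ j′))) ≈⟨ sum-single {N} _ j (λ j′ j′≢j →
          ≈-reflexive (δ-≢ p (suc⁺ (toℕ i)) (suc⁺ (toℕ j′)) (λ eq →
            j′≢j (Fin.toℕ-injective (ℕ.suc-injective (sym (cong proj₂ eq))))))) ⟩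
        δ p (suc⁺ (toℕ i)) (suc⁺ (toℕ j))                   ≡⟨ δ-≡ p (suc⁺ (toℕ i)) (suc⁺ (toℕ j)) refl ⟩
        f (suc⁺ (toℕ j))                                    ∎

      count-∷ : ∀ p ps d k → count (p ∷ ps) d k · f k ≈ δ p d k + count ps d k · f k
      count-∷ p ps d k = case vals≟ p d k of λ where
        (yes eq) → ≈-trans (×-congˡ (count-≡ p ps {d} {k} eq)) (+-congʳ (≈-reflexive (sym (δ-≡ p d k eq))))
        (no neq) → ≈-trans (×-congˡ (count-≢ p ps {d} {k} neq))
          (≈-trans (≈-sym (+-identityˡ _)) (+-congʳ (≈-reflexive (sym (δ-≢ p d k neq)))))

    ∑∑-count : ∀ ps →
      (∀ {p} → p Mem.∈ ps → (val (proj₁ p) ℕ.≤ N × val (proj₂ p) ℕ.≤ N) ⊎ f (proj₂ p) ≈ 0#) →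
      ∑∑ (λ d k → count ps d k · f k) ≈ ∑ ps (f ∘ proj₂)
    ∑∑-count []       _     = sum-zero {N} _ (λ _ → sum-zero {N} _ (λ _ → ≈-refl))
    ∑∑-count (p ∷ ps) inside = begin
      ∑∑ (λ d k → count (p ∷ ps) d k · f k)            ≈⟨ sum-cong-≋ {N} (λ i → sum-cong-≋ {N} (λ j → count-∷ p ps (suc⁺ (toℕ i)) (suc⁺ (toℕ j)))) ⟩
      ∑∑ (λ d k → δ p d k + count ps d k · f k)        ≈⟨ sum-cong-≋ {N} (λ i → ∑-distrib-+ {N} _ _) ⟩
      sum {N} (λ i → sum {N} (λ j → δ p (suc⁺ (toℕ i)) (suc⁺ (toℕ j)))
                   + sum {N} (λ j → count ps (suc⁺ (toℕ i)) (suc⁺ (toℕ j)) · f (suc⁺ (toℕ j))))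
                                                       ≈⟨ ∑-distrib-+ {N} _ _ ⟩
      ∑∑ (δ p) + ∑∑ (λ d k → count ps d k · f k)       ≈⟨ +-cong (∑∑δ p (inside (here refl))) (∑∑-count ps (inside ∘ there)) ⟩
      f (proj₂ p) + ∑ ps (f ∘ proj₂)                   ∎

  -- The relation `IsSum` over an arbitrary monoid; for the additive monoid of ℂ it unfolds to
  -- `IsSum` itself.
  IsDoubleSum : (ℕ⁺ → ℕ⁺ → Carrier) → Carrier → Set ℓ
  IsDoubleSum h s = ∃[ N ]
      (∀ d k → N ℕ.< val d ⊎ N ℕ.< val k → h d k ≈ 0#)
    × s ≈ sum {N} (λ i → sum {N} (λ j → h (suc⁺ (toℕ i)) (suc⁺ (toℕ j))))

  module _ (ps : List (ℕ⁺ × ℕ⁺)) {m : ℕ⁺ → ℕ⁺ → ℕ} (m≡count : ∀ d k → m d k ≡ count ps d k)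
           (f : ℕ⁺ → Carrier) {s : Carrier} where

    private
      ∑∑-m : ∀ N →
        (∀ {p} → p Mem.∈ ps → (val (proj₁ p) ℕ.≤ N × val (proj₂ p) ℕ.≤ N) ⊎ f (proj₂ p) ≈ 0#) →
        sum {N} (λ i → sum {N} (λ j → m (suc⁺ (toℕ i)) (suc⁺ (toℕ j)) · f (suc⁺ (toℕ j)))) ≈ ∑ ps (f ∘ proj₂)
      ∑∑-m N inside = ≈-trans
        (sum-cong-≋ {N} (λ i → sum-cong-≋ {N} (λ j → ×-congˡ (m≡count (suc⁺ (toℕ i)) (suc⁺ (toℕ j))))))
        (∑∑-count f N ps inside)

    isDoubleSum⇒≈ : TorsionFree → IsDoubleSum (λ d k → m d k · f k) s → s ≈ ∑ ps (f ∘ proj₂)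
    isDoubleSum⇒≈ torsion-free (N , vanish , s≈) = ≈-trans s≈ (∑∑-m N inside)
      where
      -- A listed pair has positive count, so the vanishing of its product outside the square is the
      -- vanishing of a positive multiple of `f`.
      outside : ∀ {p} → p Mem.∈ ps → N ℕ.< val (proj₁ p) ⊎ N ℕ.< val (proj₂ p) → f (proj₂ p) ≈ 0#
      outside {d , k} p∈ N< with n , eq ← count≢0 p∈ =
        torsion-free n (subst (λ n → n · f k ≈ 0#) (trans (m≡count d k) eq) (vanish d k N<))
      inside : ∀ {p} → p Mem.∈ ps → (val (proj₁ p) ℕ.≤ N × val (proj₂ p) ℕ.≤ N) ⊎ f (proj₂ p) ≈ 0#
      inside {d , k} p∈ with val d ℕ.≤? N | val k ℕ.≤? N
      ... | yes d≤N | yes k≤N = inj₁ (d≤N , k≤N)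
      ... | no d≰N  | _       = inj₂ (outside p∈ (inj₁ (ℕ.≰⇒> d≰N)))
      ... | yes _   | no k≰N  = inj₂ (outside p∈ (inj₂ (ℕ.≰⇒> k≰N)))

    -- Serves the counterexample in (iv), which has to satisfy the hypothesis of property R; there a
    -- square containing all listed pairs is at hand.
    ≈⇒isDoubleSum : ∀ N → (∀ {p} → p Mem.∈ ps → val (proj₁ p) ℕ.≤ N × val (proj₂ p) ℕ.≤ N) →
      s ≈ ∑ ps (f ∘ proj₂) → IsDoubleSum (λ d k → m d k · f k) s
    ≈⇒isDoubleSum N bounded s≈ = N , vanish , ≈-trans s≈ (≈-sym (∑∑-m N (inj₁ ∘ bounded)))
      where
      vanish : ∀ d k → N ℕ.< val d ⊎ N ℕ.< val k → m d k · f k ≈ 0#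
      vanish d k N< = ≈-reflexive (cong (_· f k) (trans (m≡count d k) (count≡0 ps {d} {k} (absent N<))))
        where
        absent : N ℕ.< val d ⊎ N ℕ.< val k → ∀ {p} → p Mem.∈ ps → vals p ≢ (val d , val k)
        absent (inj₁ N<d) p∈ eq = ℕ.<⇒≱ N<d (subst (ℕ._≤ N) (cong proj₁ eq) (proj₁ (bounded p∈)))
        absent (inj₂ N<k) p∈ eq = ℕ.<⇒≱ N<k (subst (ℕ._≤ N) (cong proj₂ eq) (proj₂ (bounded p∈)))

-- Typings with one model list per type.

module ℂSum = ListSum ℂ-+-commutativeMonoid

-- A typing all of whose intervals of type n look alike: model n lists the
-- pairs (type of [x,z], type of [z,y]) for z in [x,y].
record ModelledTyping (P : Poset c ℓ₁ ℓ₂) : Set (c l⊔ ℓ₁ l⊔ ℓ₂) where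
  open Poset P using (_≤_) renaming (Carrier to X; _≈_ to _≈P_; trans to ≤-trans; module Eq to EqP)
  field
    locallyFinite  : LocallyFinite P
  open LocallyFinite locallyFinite
  field
    type           : X → X → ℕ
    type-cong      : ∀ {x x′ y y′} → x ≈P x′ → y ≈P y′ → type x y ≡ type x′ y′
    type≢0⇔≤       : ∀ x y → type x y ≢ 0 ⇔ x ≤ y
    surjective     : ∀ (n : ℕ⁺) → ∃[ x ] ∃[ y ] type x y ≡ val n
    model          : ℕ⁺ → List (ℕ⁺ × ℕ⁺)
    interval-types : ∀ n {x y} → type x y ≡ val n →
      map (λ z → type x z , type z y) (interval x y) ≡ map vals (model n)

  private
    -- `DependsOnlyOn` also compares pairs of type 0, about which the models say nothing; for them
    -- the convolution is an empty sum.
    empty-interval : ∀ {x y} → type x y ≡ 0 → interval x y ≡ []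
    empty-interval {x} {y} eq with interval x y in eqI
    ... | []    = refl
    ... | z ∷ _ = contradiction eq (Equivalence.from (type≢0⇔≤ x y) (≤-trans (proj₁ x≤z≤y) (proj₂ x≤z≤y)))
      where x≤z≤y = Equivalence.to (interval-members x y z) (subst (SetoidMem._∈_ EqP.setoid z) (sym eqI) (here EqP.refl))

    interval-types-≡ : ∀ t {x y x′ y′} → type x y ≡ t → type x′ y′ ≡ t →
      map (λ z → type x z , type z y) (interval x y) ≡ map (λ z → type x′ z , type z y′) (interval x′ y′)
    interval-types-≡ zero    eq eq′ rewrite empty-interval eq | empty-interval eq′ = refl
    interval-types-≡ (suc t) eq eq′ = trans (interval-types (suc⁺ t) eq) (sym (interval-types (suc⁺ t) eq′))

  typing : SurjectiveTyping P
  typing = record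
    { locallyFinite = locallyFinite
    ; type          = type
    ; type-cong     = type-cong
    ; type≢0⇔≤      = type≢0⇔≤
    ; surjective    = surjective
    ; convolution-closed = λ f₁ f₂ f₁-dep f₂-dep x y x′ y′ eq →
        ℂSum.∑-map-≡ (λ z → type x z , type z y) (λ z → type x′ z , type z y′) (interval x y) (interval x′ y′)
          (interval-types-≡ (type x y) refl (sym eq))
          (λ z z′ eqs → ℂ-*-cong {f₁ x z} {f₁ x′ z′} {f₂ z y} {f₂ z′ y′}
             (f₁-dep x z x′ z′ (cong proj₁ eqs)) (f₂-dep z y z′ y′ (cong proj₂ eqs)))
    }

  open SurjectiveTyping typing using (bracket)

  bracket≡count : ∀ n d k → bracket n d k ≡ count (model n) d k
  bracket≡count n d k with surjective n
  ... | x , y , eq = trans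
    (length-filter-map (pair≟ (val d) (val k)) (λ z → type x z , type z y) (interval x y))
    (cong (λ ps → length (filter (pair≟ (val d) (val k)) ps)) (interval-types n eq))

-- Reduction of property R to functions vanishing above a bound.

finite⇒bounded : ∀ xs → ∃[ N ] ∀ {n} → n Mem.∈ xs → val n ℕ.≤ N
finite⇒bounded []       = 0 , λ ()
finite⇒bounded (x ∷ xs) with N , h ← finite⇒bounded xs =
  val x ℕ.⊔ N , λ { (here refl) → ℕ.m≤m⊔n (val x) N ; (there n∈) → ℕ.≤-trans (h n∈) (ℕ.m≤n⊔m (val x) N) }

VanishesAbove : ℕ → (ℕ⁺ → ℂ) → Set
VanishesAbove N f = ∀ n → N ℕ.< val n → f n ≈ℂ 0ℂ

-- Beyond the largest listed number, `f n` cannot be different from 0; stability of equality turns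
-- this into `f n ≈ℂ 0ℂ`.
finite-support⇒vanishesAbove : ∀ {f} → Finite (support f) → ∃[ N ] VanishesAbove N f
finite-support⇒vanishesAbove {f} (xs , h) with N , bound ← finite⇒bounded xs =
  N , λ n N<n → ℂ-≈-stable {f n} {0ℂ} (λ f≉0 → ℕ.<⇒≱ N<n (bound (h n f≉0)))

-- The goal is a contradiction and `Infinite` is itself a negation, so proving either alternative
-- hands over a list containing the support. Both supports may therefore be taken finite at once.
propertyR : {P : Poset c ℓ₁ ℓ₂} (T : ModelledTyping P) →
  (∀ f g N → VanishesAbove N f → VanishesAbove N g →
    (∀ n → g n ≈ℂ ℂSum.∑ (ModelledTyping.model T n) (f ∘ proj₂)) → ∀ n → f n ≈ℂ 0ℂ) →
  PropertyR (ModelledTyping.typing T)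
propertyR T uncertainty f g f≢0 _ g≈ ¬infinite = ¬infinite (inj₁ λ f-finite → ¬infinite (inj₂ λ g-finite →
  let M , f≈0 = finite-support⇒vanishesAbove {f} f-finite
      N , g≈0 = finite-support⇒vanishesAbove {g} g-finite
  in f≢0 (uncertainty f g (M ℕ.⊔ N)
       (λ n n> → f≈0 n (ℕ.≤-<-trans (ℕ.m≤m⊔n M N) n>))
       (λ n n> → g≈0 n (ℕ.≤-<-trans (ℕ.m≤n⊔m M N) n>))
       (λ n → ℂSum.isDoubleSum⇒≈ (model n) (bracket≡count n) f {g n} ℂ-torsion-free (g≈ n)))))
  where
  open ModelledTyping T

-- Combinatorics of echelon forms.

-- Reduced row echelon forms, i.e. subspaces W of dimension k of 𝔽_q^n. Either W contains
-- the first basis vector e, or it is the graph over its image modulo e of a linear form,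
-- given by its k values on the basis of the image. For q = 1 these are the subsets of
-- {1,…,n} of size k, and for q = 0 there is exactly one for each k ≤ n, as in a chain.
data Echelon (q : ℕ) : ℕ → ℕ → Set where
  []    : Echelon q 0 0
  pivot : Echelon q n k → Echelon q (suc n) (suc k)
  graph : Vec (Fin q) k → Echelon q n k → Echelon q (suc n) k

echelon⇒≤ : ∀ {q} → Echelon q n k → k ℕ.≤ n
echelon⇒≤ []          = z≤n
echelon⇒≤ (pivot s)   = s≤s (echelon⇒≤ s)
echelon⇒≤ (graph _ s) = ℕ.m≤n⇒m≤1+n (echelon⇒≤ s)

words : ∀ q k → List (Vec (Fin q) k)
words q zero    = [] ∷ []
words q (suc k) = cartesianProductWith _∷_ (allFin q) (words q k)

length-cartesianProductWith : ∀ {C : Set c} (f : A → B → C) xs ys →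
  length (cartesianProductWith f xs ys) ≡ length xs ℕ.* length ys
length-cartesianProductWith f []       ys = refl
length-cartesianProductWith f (x ∷ xs) ys = trans (length-++ (map (f x) ys))
  (cong₂ ℕ._+_ (length-map (f x) ys) (length-cartesianProductWith f xs ys))

length-words : ∀ q k → length (words q k) ≡ q ^ k
length-words q zero    = refl
length-words q (suc k) = trans (length-cartesianProductWith _∷_ (allFin q) (words q k))
  (cong₂ ℕ._*_ (length-tabulate {n = q} (λ i → i)) (length-words q k))

words-unique : ∀ q k → Unique (words q k)
words-unique q zero    = [] ∷ []
words-unique q (suc k) = Unique.cartesianProductWith⁺ _∷_ ∷ᵥ-injective (Unique.allFin⁺ q) (words-unique q k)

∈-words : ∀ {q} (w : Vec (Fin q) k) → w Mem.∈ words q k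
∈-words []      = here refl
∈-words (i ∷ w) = ∈-cartesianProductWith⁺ _∷_ (∈-allFin i) (∈-words w)

private
  pivots : ∀ {q n} → ∃ (Echelon q n) → ∃ (Echelon q (suc n))
  pivots (k , s) = suc k , pivot s

  graphs : ∀ {q n} → ∃ (Echelon q n) → List (∃ (Echelon q (suc n)))
  graphs {q} (k , s) = map (λ w → k , graph w s) (words q k)

echelons : ∀ q n → List (∃ (Echelon q n))
echelons q zero    = (0 , []) ∷ []
echelons q (suc n) = map pivots (echelons q n) ++ concatMap graphs (echelons q n)

echelons-unique : ∀ q n → Unique (echelons q n)
echelons-unique q zero    = [] ∷ []
echelons-unique q (suc n) = Unique.++⁺
  (Unique.map⁺ pivots-injective (echelons-unique q n))
  (Unique.concat⁺ (All.map⁺ (All.universal graphs-unique (echelons q n)))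
                  (AllPairs.map⁺ (AllPairs.map graphs-disjoint (echelons-unique q n))))
  pivots-graphs-disjoint
  where
  pivots-injective : ∀ {s s′ : ∃ (Echelon q n)} → pivots s ≡ pivots s′ → s ≡ s′
  pivots-injective refl = refl
  graphs-unique : ∀ (s : ∃ (Echelon q n)) → Unique (graphs s)
  graphs-unique (k , s) = Unique.map⁺ (λ { refl → refl }) (words-unique q k)
  ∈-graphs : ∀ {s : ∃ (Echelon q n)} {t} → t Mem.∈ graphs s → ∃[ w ] t ≡ (proj₁ s , graph w (proj₂ s))
  ∈-graphs t∈ with w , _ , eq ← ∈-map⁻ _ t∈ = w , eq
  graphs-disjoint : ∀ {s s′ : ∃ (Echelon q n)} → s ≢ s′ → ∀ {t} → ¬ (t Mem.∈ graphs s × t Mem.∈ graphs s′)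
  graphs-disjoint s≢s′ (t∈ , t∈′) with ∈-graphs t∈ | ∈-graphs t∈′
  ... | _ , refl | _ , refl = s≢s′ refl
  pivots-graphs-disjoint : ∀ {t} → ¬ (t Mem.∈ map pivots (echelons q n) × t Mem.∈ concatMap graphs (echelons q n))
  pivots-graphs-disjoint (t∈ , t∈′) with ∈-map⁻ _ t∈ | Mem.find (∈-concatMap⁻ graphs {xs = echelons q n} t∈′)
  ... | _ , _ , refl | _ , _ , t∈g with ∈-graphs t∈g
  ... | _ , ()

∈-echelons : ∀ {q} (s : Echelon q n k) → (k , s) Mem.∈ echelons q n
∈-echelons []                        = here refl
∈-echelons (pivot s)                 = ∈-++⁺ˡ (∈-map⁺ pivots (∈-echelons s))
∈-echelons {suc n} {q = q} (graph w s) =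
  ∈-++⁺ʳ (map pivots (echelons q n)) (∈-concatMap⁺ graphs (Mem.lose (∈-echelons s) (∈-map⁺ _ (∈-words w))))

-- A form of dimension k cuts an interval of rank n into parts of rank k and n - k; types exceed
-- ranks by one.
echelonTypes : ∀ q n → List (ℕ⁺ × ℕ⁺)
echelonTypes q n = map (λ (k , _) → suc⁺ k , suc⁺ (n ∸ k)) (echelons q n)

-- Compares exponents in `scale`: with j = n - k it says that q^n q^(N-j) = q^N q^k.
[n∸k]-complement : ∀ {N n k} → k ℕ.≤ n → n ∸ k ℕ.≤ N → n ℕ.+ (N ∸ (n ∸ k)) ≡ N ℕ.+ k
[n∸k]-complement {N} {n} {k} k≤n j≤N = begin
  n ℕ.+ (N ∸ j)                 ≡⟨ cong (ℕ._+ (N ∸ j)) (ℕ.m+[n∸m]≡n k≤n) ⟨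
  k ℕ.+ j ℕ.+ (N ∸ j)           ≡⟨ ℕ.+-assoc k j (N ∸ j) ⟩
  k ℕ.+ (j ℕ.+ (N ∸ j))         ≡⟨ cong (k ℕ.+_) (ℕ.m+[n∸m]≡n j≤N) ⟩
  k ℕ.+ N                       ≡⟨ ℕ.+-comm k N ⟩
  N ℕ.+ k                       ∎
  where
  open ≡-Reasoning
  j = n ∸ k

-- Sums over echelon forms and their uncertainty principle.

module EchelonSum (M : CommutativeMonoid c ℓ) (q : ℕ) where

  open ListSum M
  open SetoidReasoning (CommutativeMonoid.setoid M)

  -- The q-Pascal rule [n+1,k] = [n,k-1] + q^k [n,k] in summed form: a form of dimension k extends
  -- to one pivot form and to q^k graphs.
  ∑-echelons : ∀ n (K : ℕ → Carrier) → ∑ (echelons q (suc n)) (K ∘ proj₁) ≈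
    ∑ (echelons q n) (λ (k , _) → K (suc k)) + ∑ (echelons q n) (λ (k , _) → (q ^ k) · K k)
  ∑-echelons n K = begin
    ∑ (map pivots (echelons q n) ++ concatMap graphs (echelons q n)) (K ∘ proj₁)
      ≈⟨ ∑-++ (map pivots (echelons q n)) _ (K ∘ proj₁) ⟩
    ∑ (map pivots (echelons q n)) (K ∘ proj₁) + ∑ (concatMap graphs (echelons q n)) (K ∘ proj₁)
      ≈⟨ +-cong (≈-reflexive (∑-map pivots (echelons q n) (K ∘ proj₁))) (∑-concatMap graphs (echelons q n) (K ∘ proj₁)) ⟩
    ∑ (echelons q n) (λ (k , _) → K (suc k)) + ∑ (echelons q n) (λ s → ∑ (graphs s) (K ∘ proj₁))
      ≈⟨ +-congˡ (∑-cong (echelons q n) (λ {s} _ → graphs-sum s)) ⟩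
    ∑ (echelons q n) (λ (k , _) → K (suc k)) + ∑ (echelons q n) (λ (k , _) → (q ^ k) · K k) ∎
    where
    graphs-sum : ∀ s → ∑ (graphs s) (K ∘ proj₁) ≈ (q ^ proj₁ s) · K (proj₁ s)
    graphs-sum (k , s) = begin
      ∑ (graphs (k , s)) (K ∘ proj₁) ≡⟨ ∑-map (λ w → k , graph w s) (words q k) (K ∘ proj₁) ⟩
      ∑ (words q k) (λ _ → K k)      ≡⟨ ∑-const (words q k) (K k) ⟩
      length (words q k) · K k       ≡⟨ cong (_· K k) (length-words q k) ⟩
      (q ^ k) · K k                  ∎

  -- The function ζ * F on ranks: F is evaluated at the rank of the upper part of the interval.
  H : (ℕ → Carrier) → ℕ → Carrier
  H F n = ∑ (echelons q n) (λ (k , _) → F (n ∸ k))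

  R : (ℕ → Carrier) → ℕ → Carrier
  R F n = ∑ (echelons q n) (λ (k , _) → (q ^ k) · F (suc (n ∸ k)))

  -- In the Pascal rule for F(n+1-k), the pivots give back `H F n` because (n+1) - (k+1) = n - k,
  -- and the graphs give the increment `R F n`.
  H-suc : ∀ F n → H F (suc n) ≈ H F n + R F n
  H-suc F n = ≈-trans (∑-echelons n (λ k → F (suc n ∸ k))) (+-congˡ (∑-cong (echelons q n) (λ {(k , s)} _ →
    ×-congʳ (q ^ k) (≈-reflexive (cong F (ℕ.+-∸-assoc 1 (echelon⇒≤ s)))))))

  -- H F (n+1) − H F n = R F n, and q^N R F n = q^n H F′ n for F′ j = q^(N−j) F (j+1),
  -- whose support is shorter than that of F.
  H-eventually-zero⇒zero : TorsionFree → .{{_ : NonZero q}} → ∀ N {F} → (∀ j → N ℕ.≤ j → F j ≈ 0#) →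
    ∀ M → (∀ n → M ℕ.≤ n → H F n ≈ 0#) → ∀ j → F j ≈ 0#
  H-eventually-zero⇒zero _ zero F≈0 _ _ j = F≈0 j z≤n
  H-eventually-zero⇒zero torsion-free (suc N) {F} F≈0 M H≈0 = λ where
      zero    → ≈-trans (≈-sym (+-identityʳ (F 0))) (≈-trans (≈-sym (H-const M)) (H≈0 M ℕ.≤-refl))
      (suc j) → F-suc≈0 j
    where
    cancel : ∀ n .{{_ : NonZero n}} {z} → n · z ≈ 0# → z ≈ 0#
    cancel (suc n) = torsion-free n

    F′ : ℕ → Carrier
    F′ j = (q ^ (N ∸ j)) · F (suc j)

    R≈0 : ∀ n → M ℕ.≤ n → R F n ≈ 0#
    R≈0 n M≤n = begin
      R F n          ≈⟨ +-identityˡ _ ⟨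
      0# + R F n     ≈⟨ +-congʳ (H≈0 n M≤n) ⟨
      H F n + R F n  ≈⟨ H-suc F n ⟨
      H F (suc n)    ≈⟨ H≈0 (suc n) (ℕ.m≤n⇒m≤1+n M≤n) ⟩
      0#             ∎

    scale : ∀ {n k} → k ℕ.≤ n → (q ^ n) · F′ (n ∸ k) ≈ (q ^ N) · ((q ^ k) · F (suc (n ∸ k)))
    scale {n} {k} k≤n = ≈-trans (×-assocˡ z (q ^ n) (q ^ (N ∸ (n ∸ k)))) (≈-trans scale′ (≈-sym (×-assocˡ z (q ^ N) (q ^ k))))
      where
      z = F (suc (n ∸ k))
      scale′ : (q ^ n ℕ.* q ^ (N ∸ (n ∸ k))) · z ≈ (q ^ N ℕ.* q ^ k) · z
      scale′ with (n ∸ k) ℕ.≤? N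
      ... | yes j≤N = ×-congˡ (trans (sym (ℕ.^-distribˡ-+-* q n _))
                        (trans (cong (q ^_) ([n∸k]-complement k≤n j≤N)) (ℕ.^-distribˡ-+-* q N k)))
      -- Here N - j is truncated to 0 and the exponents no longer match, but both sides are
      -- multiples of F(j+1), which lies beyond the support.
      ... | no j≰N  = ≈-trans (vanish (q ^ n ℕ.* q ^ (N ∸ (n ∸ k)))) (≈-sym (vanish (q ^ N ℕ.* q ^ k)))
        where
        vanish : ∀ m → m · z ≈ 0#
        vanish m = ≈-trans (×-congʳ m (F≈0 _ (s≤s (ℕ.≰⇒≥ j≰N)))) (·-zero m)

    H′≈0 : ∀ n → M ℕ.≤ n → H F′ n ≈ 0#
    H′≈0 n M≤n = cancel (q ^ n) {{ℕ.m^n≢0 q n}} (begin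
      (q ^ n) · H F′ n                                                             ≈⟨ ·-∑ (q ^ n) (echelons q n) _ ⟩
      ∑ (echelons q n) (λ (k , _) → (q ^ n) · F′ (n ∸ k))                          ≈⟨ ∑-cong (echelons q n) (λ {(k , s)} _ → scale (echelon⇒≤ s)) ⟩
      ∑ (echelons q n) (λ (k , _) → (q ^ N) · ((q ^ k) · F (suc (n ∸ k))))         ≈⟨ ·-∑ (q ^ N) (echelons q n) _ ⟨
      (q ^ N) · R F n                                                              ≈⟨ ×-congʳ (q ^ N) (R≈0 n M≤n) ⟩
      (q ^ N) · 0#                                                                 ≈⟨ ·-zero (q ^ N) ⟩
      0#                                                                           ∎)

    F-suc≈0 : ∀ j → F (suc j) ≈ 0#
    F-suc≈0 j = cancel (q ^ (N ∸ j)) {{ℕ.m^n≢0 q (N ∸ j)}} (H-eventually-zero⇒zero torsion-free N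
      (λ j N≤j → ≈-trans (×-congʳ (q ^ (N ∸ j)) (F≈0 (suc j) (s≤s N≤j))) (·-zero (q ^ (N ∸ j)))) M H′≈0 j)

    -- Recovers index 0, which the passage to `F′` drops: once F vanishes at all positive indices
    -- the increments are 0, so F(0) = H F 0 is also the eventual value of `H F`.
    H-const : ∀ n → H F n ≈ H F 0
    H-const zero    = ≈-refl
    H-const (suc n) = begin
      H F (suc n)    ≈⟨ H-suc F n ⟩
      H F n + R F n  ≈⟨ +-congˡ (∑-zero (echelons q n) (λ {(k , _)} _ →
                          ≈-trans (×-congʳ (q ^ k) (F-suc≈0 (n ∸ k))) (·-zero (q ^ k)))) ⟩
      H F n + 0#     ≈⟨ +-identityʳ _ ⟩
      H F n          ≈⟨ H-const n ⟩
      H F 0          ∎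

  ∑-echelonTypes : ∀ f n → ∑ (echelonTypes q n) (f ∘ proj₂) ≡ H (f ∘ suc⁺) n
  ∑-echelonTypes f n = ∑-map _ (echelons q n) (f ∘ proj₂)

  uncertainty : TorsionFree → .{{_ : NonZero q}} → ∀ N (f g : ℕ⁺ → Carrier) →
    (∀ n → N ℕ.< val n → f n ≈ 0#) → (∀ n → N ℕ.< val n → g n ≈ 0#) →
    (∀ n → g (suc⁺ n) ≈ ∑ (echelonTypes q n) (f ∘ proj₂)) → ∀ n → f (suc⁺ n) ≈ 0#
  uncertainty torsion-free N f g f≈0 g≈0 g≈ = H-eventually-zero⇒zero torsion-free N
    (λ j N≤j → f≈0 (suc⁺ j) (s≤s N≤j)) N
    (λ n N≤n → ≈-trans (≈-sym (≈-trans (g≈ n) (≈-reflexive (∑-echelonTypes f n)))) (g≈0 (suc⁺ n) (s≤s N≤n)))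

-- Graded posets whose intervals are parametrised by echelon forms.

[m+n]∸[o+n]≡m∸o : ∀ m n o → (m ℕ.+ n) ∸ (o ℕ.+ n) ≡ m ∸ o
[m+n]∸[o+n]≡m∸o m n o = trans (cong₂ _∸_ (ℕ.+-comm m n) (ℕ.+-comm o n)) (ℕ.[m+n]∸[m+o]≡n∸o n m o)

-- Coordinates on the interval [x, y]. Types will be differences of heights, so the frame records
-- heights but no comparison between the embedded forms.
record Frame (P : Poset c ℓ₁ ℓ₂) (height : Poset.Carrier P → ℕ) (q : ℕ) (x y : Poset.Carrier P) : Set (c l⊔ ℓ₁ l⊔ ℓ₂) where
  open Poset P using (_≤_; _≈_) renaming (Carrier to X)
  field
    {rank}        : ℕ
    embed         : ∀ {k} → Echelon q rank k → X
    height-top    : height y ≡ rank ℕ.+ height x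
    height-embed  : ∀ {k} (s : Echelon q rank k) → height (embed s) ≡ k ℕ.+ height x
    x≤embed       : ∀ {k} (s : Echelon q rank k) → x ≤ embed s
    embed≤y       : ∀ {k} (s : Echelon q rank k) → embed s ≤ y
    injective     : ∀ {k k′} (s : Echelon q rank k) (s′ : Echelon q rank k′) →
                    embed s ≈ embed s′ → (k , s) ≡ (k′ , s′)
    complete      : ∀ {z} → x ≤ z → z ≤ y → ∃[ k ] ∃[ s ] z ≈ embed {k} s

record EchelonPoset (q : ℕ) (P : Poset c ℓ₁ ℓ₂) : Set (c l⊔ ℓ₁ l⊔ ℓ₂) where
  open Poset P using (_≤_; _≈_) renaming (Carrier to X; module Eq to ≈)
  field
    height      : X → ℕ
    height-cong : ∀ {x y} → x ≈ y → height x ≡ height y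
    _≤?_        : ∀ x y → Dec (x ≤ y)
    frame       : ∀ {x y} → x ≤ y → Frame P height q x y
    unbounded   : ∀ n → ∃[ x ] ∃[ y ] x ≤ y × height y ≡ n ℕ.+ height x

  type : X → X → ℕ
  type x y = if does (x ≤? y) then suc (height y ∸ height x) else 0

  type-≤ : ∀ {x y} → x ≤ y → type x y ≡ suc (height y ∸ height x)
  type-≤ {x} {y} x≤y = cong (if_then suc (height y ∸ height x) else 0) (dec-true (x ≤? y) x≤y)

  type-≰ : ∀ {x y} → ¬ x ≤ y → type x y ≡ 0
  type-≰ {x} {y} x≰y = cong (if_then suc (height y ∸ height x) else 0) (dec-false (x ≤? y) x≰y)

  private
    embeds : ∀ {x y} (F : Frame P height q x y) → ∃ (Echelon q (Frame.rank F)) → X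
    embeds F (_ , s) = Frame.embed F s

    enumerate : ∀ {x y} → Dec (x ≤ y) → List X
    enumerate (yes x≤y) = map (embeds (frame x≤y)) (echelons q (Frame.rank (frame x≤y)))
    enumerate (no _)    = []

    enumerate-members : ∀ {x y} (x≤?y : Dec (x ≤ y)) z → SetoidMem._∈_ ≈.setoid z (enumerate x≤?y) ⇔ (x ≤ z × z ≤ y)
    enumerate-members (no x≰y) z = mk⇔ (λ ()) (λ (x≤z , z≤y) → contradiction (Poset.trans P x≤z z≤y) x≰y)
    enumerate-members {x} {y} (yes x≤y) z = mk⇔ to from
      where
      open Frame (frame x≤y)
      to : SetoidMem._∈_ ≈.setoid z (enumerate (yes x≤y)) → x ≤ z × z ≤ y
      to z∈ with (k , s) , _ , z≈ ← SetoidMem.∈-map⁻ (≡-setoid _) ≈.setoid z∈ =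
        Poset.≤-respʳ-≈ P (≈.sym z≈) (x≤embed s) , Poset.≤-respˡ-≈ P (≈.sym z≈) (embed≤y s)
      from : x ≤ z × z ≤ y → SetoidMem._∈_ ≈.setoid z (enumerate (yes x≤y))
      from (x≤z , z≤y) with k , s , z≈ ← complete x≤z z≤y = SetoidMem.∈-resp-≈ ≈.setoid (≈.sym z≈)
        (SetoidMem.∈-map⁺ (≡-setoid _) ≈.setoid (λ { refl → ≈.refl }) (∈-echelons s))

    type-pairs : ∀ {x y} (x≤?y : Dec (x ≤ y)) m → type x y ≡ suc m →
      map (λ z → type x z , type z y) (enumerate x≤?y) ≡ map (λ (k , _) → suc k , suc (m ∸ k)) (echelons q m)
    type-pairs (no x≰y) m eq = contradiction (trans (sym (type-≰ x≰y)) eq) λ ()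
    type-pairs {x} {y} (yes x≤y) m eq = subst
      (λ m → map (λ z → type x z , type z y) (enumerate (yes x≤y)) ≡ map (λ (k , _) → suc k , suc (m ∸ k)) (echelons q m))
      (sym m≡rank) (trans (sym (map-∘ (echelons q rank))) (map-cong pair (echelons q rank)))
      where
      open Frame (frame x≤y)
      m≡rank : m ≡ rank
      m≡rank = ℕ.suc-injective (trans (sym eq) (trans (type-≤ x≤y)
        (cong suc (trans (cong (_∸ height x) height-top) (ℕ.m+n∸n≡m rank (height x))))))
      pair : ∀ ((k , s) : ∃ (Echelon q rank)) → (type x (embed s) , type (embed s) y) ≡ (suc k , suc (rank ∸ k))
      pair (k , s) = cong₂ _,_
        (trans (type-≤ (x≤embed s)) (cong suc (trans (cong (_∸ height x) (height-embed s)) (ℕ.m+n∸n≡m k (height x)))))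
        (trans (type-≤ (embed≤y s)) (cong suc (trans (cong₂ _∸_ height-top (height-embed s)) ([m+n]∸[o+n]≡m∸o rank (height x) k))))

  model : ℕ⁺ → List (ℕ⁺ × ℕ⁺)
  model (mkℕ⁺ (suc m)) = echelonTypes q m

  modelledTyping : ModelledTyping P
  modelledTyping = record
    { locallyFinite = record
      { interval         = λ x y → enumerate (x ≤? y)
      ; interval-unique  = λ x y → unique (x ≤? y)
      ; interval-members = λ x y → enumerate-members (x ≤? y)
      }
    ; type           = type
    ; type-cong      = type-cong
    ; type≢0⇔≤       = λ x y → mk⇔ (≢0⇒≤ x y) (λ x≤y eq → contradiction (trans (sym (type-≤ x≤y)) eq) λ ())
    ; surjective     = λ { (mkℕ⁺ (suc n)) → let x , y , x≤y , eq = unbounded n in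
        x , y , trans (type-≤ x≤y) (cong suc (trans (cong (_∸ height x) eq) (ℕ.m+n∸n≡m n (height x)))) }
    ; model          = model
    ; interval-types = λ { (mkℕ⁺ (suc m)) {x} {y} eq → trans (type-pairs (x ≤? y) m eq) (map-∘ (echelons q m)) }
    }
    where
    unique : ∀ {x y} (x≤?y : Dec (x ≤ y)) → SetoidUnique.Unique ≈.setoid (enumerate x≤?y)
    unique (no _)    = []
    unique (yes x≤y) = SetoidUnique.map⁺ (≡-setoid _) ≈.setoid
      (λ {(_ , s)} {(_ , s′)} → Frame.injective (frame x≤y) s s′) (echelons-unique q _)
    ≢0⇒≤ : ∀ x y → type x y ≢ 0 → x ≤ y
    ≢0⇒≤ x y ≢0 with x ≤? y
    ... | yes x≤y = x≤y
    ... | no _    = contradiction refl ≢0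
    type-cong : ∀ {x x′ y y′} → x ≈ x′ → y ≈ y′ → type x y ≡ type x′ y′
    type-cong {x} {x′} {y} {y′} x≈ y≈ = case x ≤? y of λ where
      (yes x≤y) → trans (type-≤ x≤y) (trans (cong suc (cong₂ _∸_ (height-cong y≈) (height-cong x≈)))
        (sym (type-≤ (Poset.≤-respˡ-≈ P x≈ (Poset.≤-respʳ-≈ P y≈ x≤y)))))
      (no x≰y)  → trans (type-≰ x≰y) (sym (type-≰ (λ x′≤y′ →
        x≰y (Poset.≤-respˡ-≈ P (≈.sym x≈) (Poset.≤-respʳ-≈ P (≈.sym y≈) x′≤y′)))))

  open ModelledTyping modelledTyping public using (typing)

  typing-type : ∀ {x y} → x ≤ y → SurjectiveTyping.type typing x y ≡ height y ∸ height x ℕ.+ 1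
  typing-type {x} {y} x≤y = trans (type-≤ x≤y) (ℕ.+-comm 1 (height y ∸ height x))

echelon-propertyR : ∀ {q} .{{_ : NonZero q}} {P : Poset c ℓ₁ ℓ₂} (E : EchelonPoset q P) →
  PropertyR (EchelonPoset.typing E)
echelon-propertyR {q = q} E = propertyR (EchelonPoset.modelledTyping E) λ where
  f g N f≈0 g≈0 g≈ (mkℕ⁺ (suc n)) →
    EchelonSum.uncertainty ℂ-+-commutativeMonoid q ℂ-torsion-free N f g f≈0 g≈0 (λ n → g≈ (suc⁺ n)) n

-- The usual order (iv) and its counterexample.

chain : ∀ {k n} → k ℕ.≤ n → Echelon 0 n k
chain {n = zero}  z≤n       = []
chain {n = suc n} z≤n       = graph [] (chain {n = n} z≤n)
chain             (s≤s k≤n) = pivot (chain k≤n)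

-- Over the empty set only the vector of length 0 exists, so `graph` is confined to dimension 0 and
-- each form consists of k pivots around n - k graphs.
chain-unique : (s s′ : Echelon 0 n k) → s ≡ s′
chain-unique []           []            = refl
chain-unique (pivot s)    (pivot s′)    = cong pivot (chain-unique s s′)
chain-unique (pivot _)    (graph (() ∷ _) _)
chain-unique (graph [] s) (graph [] s′) = cong (graph []) (chain-unique s s′)

usualPoset : EchelonPoset 0 ℕ⁺-usual
usualPoset = record
  { height      = val
  ; height-cong = λ x≈y → x≈y
  ; _≤?_        = λ x y → val x ℕ.≤? val y
  ; frame       = frame
  ; unbounded   = λ n → suc⁺ 0 , suc⁺ n , s≤s z≤n , sym (ℕ.+-comm n 1)
  }
  where
  frame : ∀ {x y} → val x ℕ.≤ val y → Frame ℕ⁺-usual val 0 x y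
  frame {x@(mkℕ⁺ (suc m))} {y} x≤y = record
    { embed        = λ {k} _ → suc⁺ (k ℕ.+ m)
    ; height-top   = sym (ℕ.m∸n+n≡m x≤y)
    ; height-embed = λ {k} _ → sym (ℕ.+-suc k m)
    ; x≤embed      = λ {k} _ → s≤s (ℕ.m≤n+m m k)
    ; embed≤y      = λ {k} s → ℕ.≤-trans (ℕ.≤-reflexive (sym (ℕ.+-suc k m)))
                       (ℕ.≤-trans (ℕ.+-monoˡ-≤ (suc m) (echelon⇒≤ s)) (ℕ.≤-reflexive (ℕ.m∸n+n≡m x≤y)))
    ; injective    = λ s s′ eq → same s s′ (ℕ.+-cancelʳ-≡ m _ _ (ℕ.suc-injective eq))
    ; complete     = λ {z} x≤z z≤y → val z ∸ suc m , chain (ℕ.∸-monoˡ-≤ (suc m) z≤y) ,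
                       trans (sym (ℕ.m∸n+n≡m x≤z)) (ℕ.+-suc (val z ∸ suc m) m)
    }
    where
    same : ∀ {n k k′} (s : Echelon 0 n k) (s′ : Echelon 0 n k′) → k ≡ k′ → (k , s) ≡ (k′ , s′)
    same s s′ refl = cong (_ ,_) (chain-unique s s′)

module ChainSum (M : CommutativeMonoid c ℓ) where

  open ListSum M
  open EchelonSum M 0
  open SetoidReasoning (CommutativeMonoid.setoid M)

  -- The factor 0^k singles out k = 0, where there is exactly one form. In the Pascal rule the
  -- pivots carry 0^(k+1) = 0, and the induction hypothesis for 0^k G(k) absorbs the repeated factor
  -- of the graphs.
  ∑-chain : ∀ n (G : ℕ → Carrier) → ∑ (echelons 0 n) (λ (k , _) → (0 ^ k) · G k) ≈ G 0
  ∑-chain zero    G = ≈-trans (+-identityʳ _) (×-homo-1 (G 0))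
  ∑-chain (suc n) G = begin
    ∑ (echelons 0 (suc n)) (λ (k , _) → (0 ^ k) · G k)           ≈⟨ ∑-echelons n (λ k → (0 ^ k) · G k) ⟩
    ∑ (echelons 0 n) (λ _ → 0#)
      + ∑ (echelons 0 n) (λ (k , _) → (0 ^ k) · ((0 ^ k) · G k)) ≈⟨ +-cong (∑-zero (echelons 0 n) (λ _ → ≈-refl))
                                                                      (∑-chain n (λ k → (0 ^ k) · G k)) ⟩
    0# + 1 · G 0                                                 ≈⟨ ≈-trans (+-identityˡ _) (×-homo-1 (G 0)) ⟩
    G 0                                                          ∎

  module _ {u v : Carrier} (u+v≈0 : u + v ≈ 0#) where

    -- A monoid has no negation, so the function δ₀ - δ₁ is written with a pair `u`, `v` of sum 0.
    -- Its positions 0 and 1 are the types 1 and 2.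
    dipole : ℕ⁺ → Carrier
    dipole (mkℕ⁺ 1)                   = u
    dipole (mkℕ⁺ 2)                   = v
    dipole (mkℕ⁺ (suc (suc (suc _)))) = 0#

    monopole : ℕ⁺ → Carrier
    monopole (mkℕ⁺ 1)             = u
    monopole (mkℕ⁺ (suc (suc _))) = 0#

    private
      H-dipole : ∀ n → H (dipole ∘ suc⁺) n ≈ monopole (suc⁺ n)
      step : ∀ n → H (dipole ∘ suc⁺) (suc n) ≈ monopole (suc⁺ n) + dipole (suc⁺ (suc n))
      H-dipole zero          = +-identityʳ u
      H-dipole (suc zero)    = ≈-trans (step 0) u+v≈0
      H-dipole (suc (suc n)) = ≈-trans (step (suc n)) (+-identityˡ 0#)
      step n = ≈-trans (H-suc (dipole ∘ suc⁺) n)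
        (+-cong (H-dipole n) (∑-chain n (λ k → dipole (suc⁺ (suc (n ∸ k))))))

    monopole≈∑dipole : ∀ n → monopole (suc⁺ n) ≈ ∑ (echelonTypes 0 n) (dipole ∘ proj₂)
    monopole≈∑dipole n = ≈-sym (≈-trans (≈-reflexive (∑-echelonTypes dipole n)) (H-dipole n))

usual-¬propertyR : ¬ PropertyR (EchelonPoset.typing usualPoset)
usual-¬propertyR propertyR = propertyR f g (λ f≈0 → 1ℂ≉0ℂ (f≈0 (suc⁺ 0))) (λ g≈0 → 1ℂ≉0ℂ (g≈0 (suc⁺ 0))) isSum λ where
    (inj₁ infinite) → infinite (suc⁺ 0 ∷ suc⁺ 1 ∷ [] , f-support)
    (inj₂ infinite) → infinite (suc⁺ 0 ∷ [] , g-support)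
  where
  open ModelledTyping (EchelonPoset.modelledTyping usualPoset)
  open SurjectiveTyping typing using (bracket)
  f g : ℕ⁺ → ℂ
  f = ChainSum.dipole ℂ-+-commutativeMonoid {ℂR.1#} {ℂR.- ℂR.1#} 1ℂ-1ℂ≈0ℂ
  g = ChainSum.monopole ℂ-+-commutativeMonoid {ℂR.1#} {ℂR.- ℂR.1#} 1ℂ-1ℂ≈0ℂ
  0≈0 : 0ℂ ≈ℂ 0ℂ
  0≈0 = ℂSum.≈-refl {0ℂ}
  f-support : ∀ n → support f n → n Mem.∈ suc⁺ 0 ∷ suc⁺ 1 ∷ []
  f-support (mkℕ⁺ 1)                   _   = here refl
  f-support (mkℕ⁺ 2)                   _   = there (here refl)
  f-support (mkℕ⁺ (suc (suc (suc _)))) f≉0 = contradiction 0≈0 f≉0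
  g-support : ∀ n → support g n → n Mem.∈ suc⁺ 0 ∷ []
  g-support (mkℕ⁺ 1)             _   = here refl
  g-support (mkℕ⁺ (suc (suc _))) g≉0 = contradiction 0≈0 g≉0
  isSum : ∀ n → IsSum (λ d k → bracket n d k ℂΣ.× f k) (g n)
  isSum n@(mkℕ⁺ (suc m)) = ℂSum.≈⇒isDoubleSum (echelonTypes 0 m) (bracket≡count n) f {g n} (suc m)
    bounded (ChainSum.monopole≈∑dipole ℂ-+-commutativeMonoid {ℂR.1#} {ℂR.- ℂR.1#} 1ℂ-1ℂ≈0ℂ m)
    where
    bounded : ∀ {p} → p Mem.∈ echelonTypes 0 m → val (proj₁ p) ℕ.≤ suc m × val (proj₂ p) ℕ.≤ suc m
    bounded p∈ with (k , s) , _ , refl ← ∈-map⁻ _ p∈ = s≤s (echelon⇒≤ s) , s≤s (ℕ.m∸n≤m m k)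

-- The divisibility poset (i).

infixl 7 _*⁺_
_*⁺_ : ℕ⁺ → ℕ⁺ → ℕ⁺
mkℕ⁺ m *⁺ mkℕ⁺ n = mkℕ⁺ (m * n) {{ℕ.m*n≢0 m n}}

-- Exact when d divides n; otherwise a junk value.
cofactor : ℕ⁺ → ℕ⁺ → ℕ⁺
cofactor n d = suc⁺ (pred (val n / val d))

cofactor-* : ∀ n d e → val n ≡ val d * val e → cofactor n d ≡ e
cofactor-* (mkℕ⁺ n) (mkℕ⁺ d) (mkℕ⁺ (suc e)) refl =
  cong (λ m → suc⁺ (pred m)) (trans (cong (_/ d) (ℕ.*-comm d (suc e))) (ℕ.m*n/n≡m (suc e) d))

∣⇒cofactor : ∀ {n d} → val d ∣ val n → val n ≡ val d * val (cofactor n d)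
∣⇒cofactor {mkℕ⁺ (suc n)} {d} (divides (suc e) eq) = trans eq′ (cong (λ m → val d * val m) (sym (cofactor-* _ d (suc⁺ e) eq′)))
  where eq′ = trans eq (ℕ.*-comm (suc e) (val d))

divisors : ℕ⁺ → List ℕ⁺
divisors n = filter (λ d → val d ∣? val n) (map suc⁺ (upTo (val n)))

divisors-unique : ∀ n → Unique (divisors n)
divisors-unique n = Unique.filter⁺ (λ d → val d ∣? val n) (Unique.map⁺ (λ { refl → refl }) (Unique.upTo⁺ (val n)))

∈-divisors⁺ : ∀ {n d} → val d ∣ val n → d Mem.∈ divisors n
∈-divisors⁺ {n} {mkℕ⁺ (suc d)} d∣n = ∈-filter⁺ (λ d → val d ∣? val n) (∈-map⁺ suc⁺ (∈-upTo⁺ (ℕ.∣⇒≤ {{val-nonZero n}} d∣n))) d∣n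

∈-divisors⁻ : ∀ {n d} → d Mem.∈ divisors n → val d ∣ val n
∈-divisors⁻ {n} d∈ = proj₂ (∈-filter⁻ (λ d → val d ∣? val n) {xs = map suc⁺ (upTo (val n))} d∈)

divisorTypes : ℕ⁺ → List (ℕ⁺ × ℕ⁺)
divisorTypes n = map (λ d → d , cofactor n d) (divisors n)

module Divisibility where

  open Poset ℕ⁺-divisibility using () renaming (module Eq to ≈)

  type : ℕ⁺ → ℕ⁺ → ℕ
  type x y = if does (val x ∣? val y) then val y / val x else 0

  type-∣ : ∀ {x y} → val x ∣ val y → type x y ≡ val y / val x
  type-∣ {x} {y} x∣y = cong (if_then val y / val x else 0) (dec-true (val x ∣? val y) x∣y)

  type-∤ : ∀ {x y} → ¬ (val x ∣ val y) → type x y ≡ 0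
  type-∤ {x} {y} x∤y = cong (if_then val y / val x else 0) (dec-false (val x ∣? val y) x∤y)

  type-* : ∀ x e {y} → val y ≡ val x * e → type x y ≡ e
  type-* x e {y} eq = trans (type-∣ {x} {y} (divides e (trans eq (ℕ.*-comm (val x) e))))
    (trans (cong (_/ val x) (trans eq (ℕ.*-comm (val x) e))) (ℕ.m*n/n≡m e (val x)))

  type≢0⇒∣ : ∀ x y → type x y ≢ 0 → val x ∣ val y
  type≢0⇒∣ x y ≢0 with val x ∣? val y
  ... | yes x∣y = x∣y
  ... | no _    = contradiction refl ≢0

  enumerate : ∀ {x y} → Dec (val x ∣ val y) → List ℕ⁺
  enumerate {x} {y} (yes _) = map (x *⁺_) (divisors (cofactor y x))
  enumerate         (no _)  = []

  enumerate-unique : ∀ {x y} (x∣?y : Dec (val x ∣ val y)) → SetoidUnique.Unique ≈.setoid (enumerate {x} {y} x∣?y)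
  enumerate-unique (no _)              = []
  enumerate-unique {x} {y} (yes _) = SetoidUnique.map⁺ (≡-setoid ℕ⁺) ≈.setoid
    (λ eq → val-injective (ℕ.*-cancelˡ-≡ _ _ (val x) eq)) (divisors-unique (cofactor y x))

  enumerate-members : ∀ {x y} (x∣?y : Dec (val x ∣ val y)) z →
    SetoidMem._∈_ ≈.setoid z (enumerate {x} {y} x∣?y) ⇔ (val x ∣ val z × val z ∣ val y)
  enumerate-members (no x∤y) z = mk⇔ (λ ()) (λ (x∣z , z∣y) → contradiction (ℕ.∣-trans x∣z z∣y) x∤y)
  enumerate-members {x} {y} (yes x∣y) z = mk⇔ to from
    where
    to : SetoidMem._∈_ ≈.setoid z (enumerate {x} {y} (yes x∣y)) → val x ∣ val z × val z ∣ val y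
    to z∈ with d , d∈ , z≡ ← SetoidMem.∈-map⁻ (≡-setoid ℕ⁺) ≈.setoid {v = z} z∈ =
        divides (val d) (trans z≡ (ℕ.*-comm (val x) (val d)))
      , subst₂ _∣_ (sym z≡) (sym (∣⇒cofactor {y} {x} x∣y)) (ℕ.*-monoʳ-∣ (val x) (∈-divisors⁻ {cofactor y x} d∈))
    from : val x ∣ val z × val z ∣ val y → SetoidMem._∈_ ≈.setoid z (enumerate {x} {y} (yes x∣y))
    from (x∣z , z∣y) = SetoidMem.∈-resp-≈ ≈.setoid {x = x *⁺ cofactor z x} {y = z} (sym z≡) (SetoidMem.∈-map⁺ (≡-setoid ℕ⁺) ≈.setoid (λ { refl → refl })
      (∈-divisors⁺ {cofactor y x} (ℕ.*-cancelˡ-∣ (val x) (subst₂ _∣_ z≡ (∣⇒cofactor {y} {x} x∣y) z∣y))))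
      where z≡ = ∣⇒cofactor {z} {x} x∣z

  -- Division by x carries [x, y] onto the divisors of y / x = n; the element x d then has type d
  -- from below and n / d from above.
  enumerate-types : ∀ n {x y} (x∣?y : Dec (val x ∣ val y)) → type x y ≡ val n →
    map (λ z → type x z , type z y) (enumerate {x} {y} x∣?y) ≡ map vals (divisorTypes n)
  enumerate-types n {x} {y} (no x∤y) eq = contradiction (trans (sym eq) (type-∤ {x} {y} x∤y)) (ℕ.≢-nonZero⁻¹ (val n) {{val-nonZero n}})
  enumerate-types n {x} {y} (yes x∣y) eq = begin
    map (λ z → type x z , type z y) (map (x *⁺_) (divisors (cofactor y x)))
                                                                 ≡⟨ cong (λ m → map _ (map (x *⁺_) (divisors m))) n≡ ⟩
    map (λ z → type x z , type z y) (map (x *⁺_) (divisors n))   ≡⟨ map-∘ (divisors n) ⟨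
    map (λ d → type x (x *⁺ d) , type (x *⁺ d) y) (divisors n)   ≡⟨ map-cong-local (All.tabulate pair) ⟩
    map (λ d → val d , val (cofactor n d)) (divisors n)          ≡⟨ map-∘ (divisors n) ⟩
    map vals (divisorTypes n)                                    ∎
    where
    open ≡-Reasoning
    y≡x*n : val y ≡ val x * val n
    y≡x*n = trans (∣⇒cofactor {y} {x} x∣y) (cong (val x *_)
      (trans (sym (type-* x _ {y} (∣⇒cofactor {y} {x} x∣y))) eq))
    n≡ : cofactor y x ≡ n
    n≡ = cofactor-* y x n y≡x*n
    pair : ∀ {d} → d Mem.∈ divisors n → (type x (x *⁺ d) , type (x *⁺ d) y) ≡ (val d , val (cofactor n d))
    pair {d} d∈ = cong₂ _,_ (type-* x (val d) {x *⁺ d} refl) (type-* (x *⁺ d) (val (cofactor n d)) {y}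
      (trans y≡x*n (trans (cong (val x *_) (∣⇒cofactor {n} {d} (∈-divisors⁻ {n} d∈))) (sym (ℕ.*-assoc (val x) (val d) _)))))

  modelledTyping : ModelledTyping ℕ⁺-divisibility
  modelledTyping = record
    { locallyFinite  = record
      { interval         = λ x y → enumerate {x} {y} (val x ∣? val y)
      ; interval-unique  = λ x y → enumerate-unique {x} {y} (val x ∣? val y)
      ; interval-members = λ x y → enumerate-members {x} {y} (val x ∣? val y)
      }
    ; type           = type
    ; type-cong      = λ {x} {x′} {y} {y′} x≈ y≈ → cong₂ type (val-injective {x} {x′} x≈) (val-injective {y} {y′} y≈)
    ; type≢0⇔≤       = λ x y → mk⇔ (type≢0⇒∣ x y) (λ x∣y eq →
        ℕ.≢-nonZero⁻¹ (val (cofactor y x)) (trans (sym (type-* x _ {y} (∣⇒cofactor {y} {x} x∣y))) eq))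
    ; surjective     = λ n → suc⁺ 0 , n , type-* (suc⁺ 0) (val n) {n} (sym (ℕ.*-identityˡ (val n)))
    ; model          = divisorTypes
    ; interval-types = λ n {x} {y} → enumerate-types n {x} {y} (val x ∣? val y)
    }

-- Uncertainty for divisor sums.

module DivisorSum (M : CommutativeMonoid c ℓ) where

  open ListSum M

  -- Since e divides e! and hence N!, a common divisor of e and N! + 1 divides 1.
  coprime-N!+1 : ∀ {N e} .{{_ : NonZero e}} → e ℕ.≤ N → Coprime e (suc (N !))
  coprime-N!+1 {N} {e} e≤N {d} (d∣e , d∣N!+1) = ℕ.∣1⇒≡1 (ℕ.∣m+n∣m⇒∣n
    (subst (d ∣_) (ℕ.+-comm 1 (N !)) d∣N!+1) (ℕ.∣-trans (ℕ.∣-trans d∣e (e∣e! e)) (ℕ.m≤n⇒m!∣n! e≤N)))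
    where
    e∣e! : ∀ e .{{_ : NonZero e}} → e ∣ e !
    e∣e! (suc e) = ℕ.m∣m*n (e !)

  -- A divisor e ≤ N of (N! + 1) n already divides n, so all terms of the vanishing sum
  -- over the divisors of (N! + 1) n but the one of f n are zero by induction.
  uncertainty : ∀ N (f g : ℕ⁺ → Carrier) →
    (∀ n → N ℕ.< val n → f n ≈ 0#) → (∀ n → N ℕ.< val n → g n ≈ 0#) →
    (∀ n → g n ≈ ∑ (divisorTypes n) (f ∘ proj₂)) → ∀ n → f n ≈ 0#
  uncertainty N f g f≈0 g≈0 g≈ n = <-rec (λ m → ∀ n → val n ≡ m → f n ≈ 0#) step (val n) n refl
    where
    M′ : ℕ⁺
    M′ = suc⁺ (N !)
    N<M′ : N ℕ.< val M′
    N<M′ = s≤s (n≤n! N)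
      where
      n≤n! : ∀ n → n ℕ.≤ n !
      n≤n! zero    = z≤n
      n≤n! (suc n) = ℕ.m≤m*n (suc n) (n !) {{ℕ._!≢0 n}}
    step : ∀ m → (∀ {m′} → m′ ℕ.< m → ∀ n → val n ≡ m′ → f n ≈ 0#) → ∀ n → val n ≡ m → f n ≈ 0#
    step _ rec n refl = ≈-trans (≈-reflexive (cong f (sym (cofactor-* y M′ n refl)))) (≈-trans (≈-sym single)
      (≈-trans (≈-sym (≈-trans (g≈ y) (≈-reflexive (∑-map _ (divisors y) (f ∘ proj₂)))))
        (g≈0 y (ℕ.<-≤-trans N<M′ (ℕ.m≤m*n (val M′) (val n) {{val-nonZero n}})))))
      where
      y : ℕ⁺
      y = M′ *⁺ n
      others : ∀ {d} → d Mem.∈ divisors y → d ≢ M′ → f (cofactor y d) ≈ 0#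
      others {d} d∈ d≢M′ with val (cofactor y d) ℕ.≤? N
      ... | no e≰N  = f≈0 (cofactor y d) (ℕ.≰⇒> e≰N)
      ... | yes e≤N = rec (ℕ.≤∧≢⇒< (ℕ.∣⇒≤ {{val-nonZero n}} e∣n) e≢n) (cofactor y d) refl
        where
        e = cofactor y d
        y≡d*e : val y ≡ val d * val e
        y≡d*e = ∣⇒cofactor {y} {d} (∈-divisors⁻ {y} d∈)
        e∣n : val e ∣ val n
        e∣n = coprime-divisor (coprime-N!+1 {N} {val e} e≤N) (divides (val d) y≡d*e)
        -- The cofactor n belongs to the divisor `M′` alone, whose term is the one left over; all
        -- other cofactors up to N are proper divisors of n.
        e≢n : val e ≢ val n
        e≢n e≡n = d≢M′ (val-injective (ℕ.*-cancelʳ-≡ (val d) (val M′) (val n) {{val-nonZero n}}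
          (trans (cong (val d *_) (sym e≡n)) (sym y≡d*e))))
      single : ∑ (divisors y) (λ d → f (cofactor y d)) ≈ f (cofactor y M′)
      single = ∑-single (divisors-unique y) (∈-divisors⁺ {y} (ℕ.m∣m*n (val n))) others

divisibility-propertyR : PropertyR (ModelledTyping.typing Divisibility.modelledTyping)
divisibility-propertyR = propertyR Divisibility.modelledTyping λ f g N →
  DivisorSum.uncertainty ℂ-+-commutativeMonoid N f g

-- Finite subsets (ii).

_≟⁺_ : DecidableEquality ℕ⁺
m ≟⁺ n = map′ val-injective (cong val) (val m ℕ.≟ val n)

module FiniteSubsets where

  open Subset using (_⊆_)

  infix 4 _∈_ _∉_ _∈?_
  _∈_ _∉_ : ℕ⁺ → List ℕ⁺ → Set
  x ∈ xs = x Mem.∈ xs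
  x ∉ xs = ¬ x ∈ xs
  _∈?_ : ∀ x xs → Dec (x ∈ xs)
  _∈?_ = mk∈? _≟⁺_

  -- Without duplicates, equality as sets is equality as multisets, hence a permutation.
  length-cong : ∀ {xs ys : List ℕ⁺} → Unique xs → Unique ys → xs ⊆ ys → ys ⊆ xs → length xs ≡ length ys
  length-cong u v xs⊆ys ys⊆xs = ↭-length (∼bag⇒↭ (unique∧set⇒bag u v (mk⇔ xs⊆ys ys⊆xs)))

  -- `pivot` keeps an element and `graph` drops it; over a one-element set the vector stored in
  -- `graph` carries no information.
  select : ∀ (cs : List ℕ⁺) {k} → Echelon 1 (length cs) k → List ℕ⁺
  select []       []          = []
  select (c ∷ cs) (pivot s)   = c ∷ select cs s
  select (c ∷ cs) (graph _ s) = select cs s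

  length-select : ∀ (cs : List ℕ⁺) {k} (s : Echelon 1 (length cs) k) → length (select cs s) ≡ k
  length-select []       []          = refl
  length-select (c ∷ cs) (pivot s)   = cong suc (length-select cs s)
  length-select (c ∷ cs) (graph _ s) = length-select cs s

  select-⊆ : ∀ cs {k} (s : Echelon 1 (length cs) k) → select cs s ⊆ cs
  select-⊆ []       []          ()
  select-⊆ (c ∷ cs) (pivot s)   (here eq)  = here eq
  select-⊆ (c ∷ cs) (pivot s)   (there x∈) = there (select-⊆ cs s x∈)
  select-⊆ (c ∷ cs) (graph _ s) x∈         = there (select-⊆ cs s x∈)

  ∉-select : ∀ {c cs k} → Unique {A = ℕ⁺} (c ∷ cs) → (s : Echelon 1 (length cs) k) → c ∉ select cs s
  ∉-select {cs = cs} u s c∈ = Unique.Unique[x∷xs]⇒x∉xs u (select-⊆ cs s c∈)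

  select-unique : ∀ {cs : List ℕ⁺} {k} → Unique cs → (s : Echelon 1 (length cs) k) → Unique (select cs s)
  select-unique {[]}     _         []          = []
  select-unique {c ∷ cs} u@(_ ∷ v) (pivot s)   =
    All.tabulate (λ x∈ c≡x → ∉-select u s (subst (_∈ select cs s) (sym c≡x) x∈)) ∷ select-unique v s
  select-unique {c ∷ cs} (_ ∷ v)   (graph _ s) = select-unique v s

  words₁-unique : ∀ {k} (w w′ : Vec (Fin 1) k) → w ≡ w′
  words₁-unique []         []          = refl
  words₁-unique (zero ∷ w) (zero ∷ w′) = cong (zero ∷_) (words₁-unique w w′)

  select-tail : ∀ {c cs k k′} → Unique {A = ℕ⁺} (c ∷ cs) → (s : Echelon 1 (length cs) k) (s′ : Echelon 1 (length cs) k′) →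
    (c ∷ select cs s) ⊆ (c ∷ select cs s′) → select cs s ⊆ select cs s′
  select-tail u s s′ sub {x} x∈ with sub {x} (there x∈)
  ... | here refl  = contradiction x∈ (∉-select u s)
  ... | there x∈s′ = x∈s′

  select-injective : ∀ {cs : List ℕ⁺} {k k′} → Unique cs → (s : Echelon 1 (length cs) k) (s′ : Echelon 1 (length cs) k′) →
    select cs s ⊆ select cs s′ → select cs s′ ⊆ select cs s →
    _≡_ {A = ∃ (Echelon 1 (length cs))} (k , s) (k′ , s′)
  select-injective {[]}     _         []          []            _  _  = refl
  select-injective {c ∷ cs} u@(_ ∷ v) (pivot s)   (pivot s′)    ⊆₁ ⊆₂
    with refl ← select-injective v s s′ (select-tail u s s′ ⊆₁) (select-tail u s′ s ⊆₂) = refl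
  select-injective {c ∷ cs} u         (pivot s)   (graph _ s′)  ⊆₁ _  = contradiction (⊆₁ (here refl)) (∉-select u s′)
  select-injective {c ∷ cs} u         (graph _ s) (pivot s′)    _  ⊆₂ = contradiction (⊆₂ (here refl)) (∉-select u s)
  select-injective {c ∷ cs} (_ ∷ v)   (graph w s) (graph w′ s′) ⊆₁ ⊆₂
    with refl ← select-injective v s s′ ⊆₁ ⊆₂ = cong (λ w → _ , graph w s) (words₁-unique w w′)

  -- The form selects the intersection of `cs` and `zs`. In the interval [A, B], `cs` will be B
  -- minus A, while `zs` also contains A, so the two cannot simply be compared by inclusion.
  select-complete : ∀ cs zs → ∃[ k ] Σ[ s ∈ Echelon 1 (length cs) k ]
    (∀ {x} → x ∈ cs → x ∈ zs → x ∈ select cs s) × (∀ {x} → x ∈ select cs s → x ∈ zs)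
  select-complete []       zs = 0 , [] , (λ ()) , (λ ())
  select-complete (c ∷ cs) zs with select-complete cs zs | c ∈? zs
  ... | k , s , ⊇ , ⊆ | yes c∈ = suc k , pivot s
        , (λ { (here eq) _ → here eq ; (there x∈) x∈zs → there (⊇ x∈ x∈zs) })
        , (λ { (here refl) → c∈ ; (there x∈) → ⊆ x∈ })
  ... | k , s , ⊇ , ⊆ | no c∉  = k , graph (Vec.replicate k zero) s
        , (λ { (here refl) x∈zs → contradiction x∈zs c∉ ; (there x∈) x∈zs → ⊇ x∈ x∈zs })
        , ⊆

  frame : ∀ {A B} → elements A ⊆ elements B → Frame finiteSubsets card 1 A B
  frame {A} {B} A⊆B = record
    { embed        = λ s → record { elements = elements A ++ select cs s ; unique = embed-unique s }
    ; height-top   = trans (length-cong (FiniteSubset.unique B)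
                       (Unique.++⁺ (FiniteSubset.unique A) cs-unique (λ (x∈A , x∈cs) → cs∉A x∈cs x∈A)) B⊆A++cs A++cs⊆B)
                       (trans (length-++ (elements A)) (ℕ.+-comm (card A) (length cs)))
    ; height-embed = λ {k} s → trans (length-++ (elements A))
                       (trans (cong (card A ℕ.+_) (length-select cs s)) (ℕ.+-comm (card A) k))
    ; x≤embed      = λ _ → ∈-++⁺ˡ
    ; embed≤y      = λ s x∈ → A++cs⊆B ([ ∈-++⁺ˡ , (λ x∈s → ∈-++⁺ʳ (elements A) (select-⊆ cs s x∈s)) ]′ (∈-++⁻ (elements A) x∈))
    ; injective    = λ s s′ eq → select-injective cs-unique s s′ (cancel s s′ (lhs≤rhs eq)) (cancel s′ s (rhs≤lhs eq))
    ; complete     = λ {Z} A⊆Z Z⊆B →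
        let k , s , ⊇ , ⊆ = select-complete cs (elements Z)
        in k , s , record { lhs≤rhs =
            (λ x∈Z → [ ∈-++⁺ˡ , (λ x∈cs → ∈-++⁺ʳ (elements A) (⊇ x∈cs x∈Z)) ]′ (∈-++⁻ (elements A) (B⊆A++cs (Z⊆B x∈Z))))
          ; rhs≤lhs = (λ x∈ → [ A⊆Z , ⊆ ]′ (∈-++⁻ (elements A) x∈)) }
    }
    where
    ∉A? : ∀ x → Dec (x ∉ elements A)
    ∉A? x = ¬? (x ∈? elements A)
    cs : List ℕ⁺
    cs = filter ∉A? (elements B)
    cs-unique : Unique cs
    cs-unique = Unique.filter⁺ ∉A? (FiniteSubset.unique B)
    cs∉A : ∀ {x} → x ∈ cs → x ∉ elements A
    cs∉A x∈ = proj₂ (∈-filter⁻ ∉A? {xs = elements B} x∈)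
    B⊆A++cs : elements B ⊆ (elements A ++ cs)
    B⊆A++cs {x} x∈B with x ∈? elements A
    ... | yes x∈A = ∈-++⁺ˡ x∈A
    ... | no x∉A  = ∈-++⁺ʳ (elements A) (∈-filter⁺ ∉A? x∈B x∉A)
    A++cs⊆B : (elements A ++ cs) ⊆ elements B
    A++cs⊆B x∈ = [ A⊆B , (λ x∈cs → proj₁ (∈-filter⁻ ∉A? {xs = elements B} x∈cs)) ]′ (∈-++⁻ (elements A) x∈)
    embed-unique : ∀ {k} (s : Echelon 1 (length cs) k) → Unique (elements A ++ select cs s)
    embed-unique s = Unique.++⁺ (FiniteSubset.unique A) (select-unique cs-unique s)
      (λ (x∈A , x∈s) → cs∉A (select-⊆ cs s x∈s) x∈A)
    cancel : ∀ {k k′} (s : Echelon 1 (length cs) k) (s′ : Echelon 1 (length cs) k′) →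
      (elements A ++ select cs s) ⊆ (elements A ++ select cs s′) → select cs s ⊆ select cs s′
    cancel s s′ sub x∈s = [ (λ x∈A → contradiction x∈A (cs∉A (select-⊆ cs s x∈s))) , (λ x∈ → x∈) ]′
      (∈-++⁻ (elements A) (sub (∈-++⁺ʳ (elements A) x∈s)))

  echelonPoset : EchelonPoset 1 finiteSubsets
  echelonPoset = record
    { height      = card
    ; height-cong = λ {A} {B} A≈B → length-cong (FiniteSubset.unique A) (FiniteSubset.unique B) (lhs≤rhs A≈B) (rhs≤lhs A≈B)
    ; _≤?_        = λ A B → DecSubset._⊆?_ _≟⁺_ (elements A) (elements B)
    ; frame       = frame
    ; unbounded   = λ n → record { elements = [] ; unique = [] }
        , record { elements = map suc⁺ (upTo n) ; unique = Unique.map⁺ (λ { refl → refl }) (Unique.upTo⁺ n) }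
        , (λ ())
        , trans (length-map suc⁺ (upTo n)) (trans (length-upTo n) (sym (ℕ.+-identityʳ n)))
    }

-- Linear algebra over a finite field, relative to a subspace.

lookup-injective : ∀ {A : Set a} {n} {v w : Vec A n} → (∀ i → lookup v i ≡ lookup w i) → v ≡ w
lookup-injective {v = v} {w} eq = trans (sym (tabulate∘lookup v)) (trans (tabulate-cong eq) (tabulate∘lookup w))

finToFun-injective : ∀ {m n} {i j : Fin (m ^ n)} → (∀ k → finToFun {m} {n} i k ≡ finToFun j k) → i ≡ j
finToFun-injective {m} {n} {i} {j} eq = trans (sym (Fin.funToFin-finToFin {n} {m} i))
  (trans (funToFin-cong eq) (Fin.funToFin-finToFin {n} {m} j))
  where
  funToFin-cong : ∀ {n} {f g : Fin n → Fin m} → (∀ k → f k ≡ g k) → funToFin f ≡ funToFin g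
  funToFin-cong {zero}  eq = refl
  funToFin-cong {suc n} eq = cong₂ combine (eq zero) (funToFin-cong (eq ∘ suc))

-- A semimodule suffices as the ambient space: the scalar -1 of the field supplies the negatives of
-- vectors.
module LinearAlgebra {c ℓ m ℓm : Level} {q : ℕ} (F : CommutativeRing c ℓ) (isFiniteField : IsFiniteField q F)
         (M : LeftSemimodule (CommutativeRing.semiring F) m ℓm) where

  private module F where
    open CommutativeRing F public
    open IsFiniteField isFiniteField public
  open F using (_≈_) renaming (Carrier to K)
  open LeftSemimodule M
  open CommutativeSemigroupProperties (CommutativeMonoid.commutativeSemigroup +ᴹ-commutativeMonoid) using (interchange)
  open CommutativeMonoidSum +ᴹ-commutativeMonoid using (sum)
  open SetoidReasoning ≈ᴹ-setoid

  encode : K → Fin q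
  encode = Inverse.to F.order-q

  decode : Fin q → K
  decode = Inverse.from F.order-q

  decode-encode : ∀ x → decode (encode x) ≈ x
  decode-encode = Inverse.strictlyInverseʳ F.order-q

  encode-injective : ∀ {x y} → encode x ≡ encode y → x ≈ y
  encode-injective {x} {y} eq = F.trans (F.sym (decode-encode x)) (F.trans (F.reflexive (cong decode eq)) (decode-encode y))

  decode-injective : ∀ {i j} → decode i ≈ decode j → i ≡ j
  decode-injective {i} {j} eq = trans (sym (Inverse.strictlyInverseˡ F.order-q i))
    (trans (Inverse.to-cong F.order-q eq) (Inverse.strictlyInverseˡ F.order-q j))

  _≟_ : ∀ x y → Dec (x ≈ y)
  x ≟ y = map′ encode-injective (Inverse.to-cong F.order-q) (encode x Fin.≟ encode y)

  1<q : 1 ℕ.< q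
  1<q = helper encode encode-injective
    where
    helper : ∀ {q} (encode : K → Fin q) → (∀ {x y} → encode x ≡ encode y → x ≈ y) → 1 ℕ.< q
    helper {zero}        encode _   with () ← encode F.0#
    helper {suc zero}    encode inj = contradiction (inj (all-≡ (encode F.1#) (encode F.0#))) F.1≉0
      where
      all-≡ : ∀ (i j : Fin 1) → i ≡ j
      all-≡ zero zero = refl
    helper {suc (suc q)} _      _   = s≤s (s≤s z≤n)

  x-y≈0⇒x≈y : ∀ {x y} → x F.- y ≈ F.0# → x ≈ y
  x-y≈0⇒x≈y {x} {y} eq = F.trans (F.sym (F.+-identityʳ x)) (F.trans (F.+-congˡ (F.sym (F.-‿inverseˡ y)))
    (F.trans (F.sym (F.+-assoc x (F.- y) y)) (F.trans (F.+-congʳ eq) (F.+-identityˡ y))))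

  [x-y]+y≈x : ∀ x y → (x F.- y) F.+ y ≈ x
  [x-y]+y≈x x y = F.trans (F.+-assoc x (F.- y) y) (F.trans (F.+-congˡ (F.-‿inverseˡ y)) (F.+-identityʳ x))

  -1#*v+v≈0 : ∀ v → (F.- F.1#) *ₗ v +ᴹ v ≈ᴹ 0ᴹ
  -1#*v+v≈0 v = begin
    (F.- F.1#) *ₗ v +ᴹ v          ≈⟨ +ᴹ-congˡ (*ₗ-identityˡ v) ⟨
    (F.- F.1#) *ₗ v +ᴹ F.1# *ₗ v  ≈⟨ *ₗ-distribʳ v (F.- F.1#) F.1# ⟨
    (F.- F.1# F.+ F.1#) *ₗ v      ≈⟨ *ₗ-congʳ (F.-‿inverseˡ F.1#) ⟩
    F.0# *ₗ v                     ≈⟨ *ₗ-zeroˡ v ⟩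
    0ᴹ                            ∎

  -1#*u+[u+v]≈v : ∀ u v → (F.- F.1#) *ₗ u +ᴹ (u +ᴹ v) ≈ᴹ v
  -1#*u+[u+v]≈v u v = begin
    (F.- F.1#) *ₗ u +ᴹ (u +ᴹ v)   ≈⟨ +ᴹ-assoc _ u v ⟨
    (F.- F.1#) *ₗ u +ᴹ u +ᴹ v     ≈⟨ +ᴹ-congʳ (-1#*v+v≈0 u) ⟩
    0ᴹ +ᴹ v                       ≈⟨ +ᴹ-identityˡ v ⟩
    v                             ∎

  +ᴹ-cancelˡ-0 : ∀ {u v w} → u +ᴹ v ≈ᴹ w → v ≈ᴹ w → u ≈ᴹ 0ᴹ
  +ᴹ-cancelˡ-0 {u} {v} {w} u+v≈w v≈w = begin
    u                            ≈⟨ -1#*u+[u+v]≈v v u ⟨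
    (F.- F.1#) *ₗ v +ᴹ (v +ᴹ u)  ≈⟨ +ᴹ-congˡ (≈ᴹ-trans (+ᴹ-comm v u) (≈ᴹ-trans u+v≈w (≈ᴹ-sym v≈w))) ⟩
    (F.- F.1#) *ₗ v +ᴹ v         ≈⟨ -1#*v+v≈0 v ⟩
    0ᴹ                           ∎

  *ₗ-+ᴹ-assoc : ∀ x y v w → (x F.+ y) *ₗ v +ᴹ w ≈ᴹ x *ₗ v +ᴹ (y *ₗ v +ᴹ w)
  *ₗ-+ᴹ-assoc x y v w = ≈ᴹ-trans (+ᴹ-congʳ (*ₗ-distribʳ v x y)) (+ᴹ-assoc _ _ w)

  lin : ∀ {k} → Vector K k → Vector Carrierᴹ k → Carrierᴹ
  lin a r = sum (λ i → a i *ₗ r i)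

  lin-cong : ∀ {k} {a b : Vector K k} (r : Vector Carrierᴹ k) → (∀ i → a i ≈ b i) → lin a r ≈ᴹ lin b r
  lin-cong {zero}  r a≈b = ≈ᴹ-refl
  lin-cong {suc k} r a≈b = +ᴹ-cong (*ₗ-congʳ (a≈b zero)) (lin-cong (r ∘ suc) (a≈b ∘ suc))

  lin-zero : ∀ {k} {a : Vector K k} (r : Vector Carrierᴹ k) → (∀ i → a i ≈ F.0#) → lin a r ≈ᴹ 0ᴹ
  lin-zero {zero}  r a≈0 = ≈ᴹ-refl
  lin-zero {suc k} r a≈0 = ≈ᴹ-trans (+ᴹ-cong (≈ᴹ-trans (*ₗ-congʳ (a≈0 zero)) (*ₗ-zeroˡ (r zero)))
    (lin-zero (r ∘ suc) (a≈0 ∘ suc))) (+ᴹ-identityˡ 0ᴹ)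

  lin-sub : ∀ {k} (a b : Vector K k) r → lin (λ i → a i F.- b i) r +ᴹ lin b r ≈ᴹ lin a r
  lin-sub {zero}  a b r = +ᴹ-identityˡ 0ᴹ
  lin-sub {suc k} a b r = begin
    (a zero F.- b zero) *ₗ r zero +ᴹ lin _ (r ∘ suc) +ᴹ (b zero *ₗ r zero +ᴹ lin (b ∘ suc) (r ∘ suc))
      ≈⟨ interchange _ _ _ _ ⟩
    (a zero F.- b zero) *ₗ r zero +ᴹ b zero *ₗ r zero +ᴹ (lin _ (r ∘ suc) +ᴹ lin (b ∘ suc) (r ∘ suc))
      ≈⟨ +ᴹ-cong (≈ᴹ-sym (*ₗ-distribʳ (r zero) _ _)) (lin-sub (a ∘ suc) (b ∘ suc) (r ∘ suc)) ⟩
    ((a zero F.- b zero) F.+ b zero) *ₗ r zero +ᴹ lin (a ∘ suc) (r ∘ suc)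
      ≈⟨ +ᴹ-congʳ (*ₗ-congʳ ([x-y]+y≈x (a zero) (b zero))) ⟩
    a zero *ₗ r zero +ᴹ lin (a ∘ suc) (r ∘ suc) ∎

  -- If `r` is a basis modulo `v`, this is the corresponding basis of the graph of the linear form
  -- with values `φ`.
  shift : ∀ {k} → Vector K k → Carrierᴹ → Vector Carrierᴹ k → Vector Carrierᴹ k
  shift φ v r j = φ j *ₗ v +ᴹ r j

  lin-shift : ∀ {k} (a φ : Vector K k) v r → ∃[ x ] lin a (shift φ v r) ≈ᴹ x *ₗ v +ᴹ lin a r
  lin-shift {zero}  a φ v r = F.0# , ≈ᴹ-sym (≈ᴹ-trans (+ᴹ-congʳ (*ₗ-zeroˡ v)) (+ᴹ-identityˡ 0ᴹ))
  lin-shift {suc k} a φ v r with x , eq ← lin-shift (a ∘ suc) (φ ∘ suc) v (r ∘ suc) = a zero F.* φ zero F.+ x , (begin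
    a zero *ₗ (φ zero *ₗ v +ᴹ r zero) +ᴹ lin (a ∘ suc) (shift (φ ∘ suc) v (r ∘ suc))
      ≈⟨ +ᴹ-cong (≈ᴹ-trans (*ₗ-distribˡ (a zero) _ (r zero)) (+ᴹ-congʳ (≈ᴹ-sym (*ₗ-assoc (a zero) (φ zero) v)))) eq ⟩
    (a zero F.* φ zero) *ₗ v +ᴹ a zero *ₗ r zero +ᴹ (x *ₗ v +ᴹ lin (a ∘ suc) (r ∘ suc))
      ≈⟨ interchange _ _ _ _ ⟩
    (a zero F.* φ zero) *ₗ v +ᴹ x *ₗ v +ᴹ (a zero *ₗ r zero +ᴹ lin (a ∘ suc) (r ∘ suc))
      ≈⟨ +ᴹ-congʳ (*ₗ-distribʳ v _ x) ⟨
    (a zero F.* φ zero F.+ x) *ₗ v +ᴹ (a zero *ₗ r zero +ᴹ lin (a ∘ suc) (r ∘ suc)) ∎)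

  -- Counting replaces the exchange lemma: the q^d combinations of `b` are distinct, so choosing
  -- coordinates along `b′` for each of them is an injection into a set of size q^d′.
  independent⇒≤ : ∀ {d d′} (b : Vector Carrierᴹ d) (b′ : Vector Carrierᴹ d′) →
    (∀ a → lin a b ≈ᴹ 0ᴹ → ∀ i → a i ≈ F.0#) → (∀ a → ∃[ a′ ] lin a b ≈ᴹ lin a′ b′) → d ℕ.≤ d′
  independent⇒≤ {d} {d′} b b′ independent expand = ℕ.≮⇒≥ (λ d′<d →
      ℕ.<⇒≱ (ℕ.^-monoʳ-< q 1<q d′<d) (Fin.injective⇒≤ {f = coefficients} injective))
    where
    vector : Fin (q ^ d) → Vector K d
    vector i = decode ∘ finToFun i
    coefficients : Fin (q ^ d) → Fin (q ^ d′)
    coefficients i = funToFin (encode ∘ proj₁ (expand (vector i)))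
    injective : ∀ {i j} → coefficients i ≡ coefficients j → i ≡ j
    injective {i} {j} eq = finToFun-injective {q} {d} (λ k → decode-injective (x-y≈0⇒x≈y
        (independent _ (+ᴹ-cancelˡ-0 (lin-sub (vector i) (vector j) b) (≈ᴹ-sym lin≈)) k)))
      where
      same : ∀ k → proj₁ (expand (vector i)) k ≈ proj₁ (expand (vector j)) k
      same k = encode-injective (trans (sym (Fin.finToFun-funToFin (encode ∘ proj₁ (expand (vector i))) k))
        (trans (cong (λ l → finToFun l k) eq) (Fin.finToFun-funToFin (encode ∘ proj₁ (expand (vector j))) k)))
      lin≈ : lin (vector i) b ≈ᴹ lin (vector j) b
      lin≈ = ≈ᴹ-trans (proj₂ (expand (vector i))) (≈ᴹ-trans (lin-cong b′ same) (≈ᴹ-sym (proj₂ (expand (vector j)))))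

  Pred : Set _
  Pred = Carrierᴹ → Set (c l⊔ ℓm)

  infix 4 _⊆_
  _⊆_ : Pred → Pred → Set _
  A ⊆ B = ∀ {v} → A v → B v

  record IsSubspace (A : Pred) : Set (c l⊔ m l⊔ ℓm) where
    field
      resp : ∀ {v w} → v ≈ᴹ w → A v → A w
      0∈   : A 0ᴹ
      +∈   : ∀ {v w} → A v → A w → A (v +ᴹ w)
      *∈   : ∀ x {v} → A v → A (x *ₗ v)

    cancelˡ : ∀ {u v} → A u → A (u +ᴹ v) → A v
    cancelˡ {u} {v} u∈ u+v∈ = resp (-1#*u+[u+v]≈v u v) (+∈ (*∈ (F.- F.1#) u∈) u+v∈)

    cancelʳ : ∀ {u v} → A v → A (u +ᴹ v) → A u
    cancelʳ {u} {v} v∈ u+v∈ = cancelˡ v∈ (resp (+ᴹ-comm u v) u+v∈)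

    lin∈ : ∀ {k} (a : Vector K k) {r} → (∀ i → A (r i)) → A (lin a r)
    lin∈ {zero}  a r∈ = 0∈
    lin∈ {suc k} a r∈ = +∈ (*∈ (a zero) (r∈ zero)) (lin∈ (a ∘ suc) (r∈ ∘ suc))

    -- A nonzero coefficient could be inverted, which would put `v` into `A`.
    coefficient≈0 : ∀ {x v} → ¬ A v → A (x *ₗ v) → x ≈ F.0#
    coefficient≈0 {x} {v} v∉ xv∈ with x ≟ F.0#
    ... | yes x≈0 = x≈0
    ... | no x≉0 with y , xy≈1 ← F.inverse x x≉0 = contradiction (resp y[xv]≈v (*∈ y xv∈)) v∉
      where
      y[xv]≈v : y *ₗ (x *ₗ v) ≈ᴹ v
      y[xv]≈v = ≈ᴹ-trans (≈ᴹ-sym (*ₗ-assoc y x v))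
        (≈ᴹ-trans (*ₗ-congʳ (F.trans (F.*-comm y x) xy≈1)) (*ₗ-identityˡ v))

    coefficients≈ : ∀ {x y v w} → ¬ A v → A (x *ₗ v +ᴹ w) → A (y *ₗ v +ᴹ w) → x ≈ y
    coefficients≈ {x} {y} {v} {w} v∉ xv+w∈ yv+w∈ = x-y≈0⇒x≈y (coefficient≈0 v∉ (cancelʳ yv+w∈ (resp (begin
      x *ₗ v +ᴹ w                           ≈⟨ +ᴹ-congʳ (*ₗ-congʳ ([x-y]+y≈x x y)) ⟨
      ((x F.- y) F.+ y) *ₗ v +ᴹ w           ≈⟨ *ₗ-+ᴹ-assoc (x F.- y) y v w ⟩
      (x F.- y) *ₗ v +ᴹ (y *ₗ v +ᴹ w)       ∎) xv+w∈)))

  open IsSubspace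

  Zero : Pred
  Zero v = Lift c (v ≈ᴹ 0ᴹ)

  Zero-isSubspace : IsSubspace Zero
  Zero-isSubspace = record
    { resp = λ v≈w (lift v≈0) → lift (≈ᴹ-trans (≈ᴹ-sym v≈w) v≈0)
    ; 0∈   = lift ≈ᴹ-refl
    ; +∈   = λ (lift v≈0) (lift w≈0) → lift (≈ᴹ-trans (+ᴹ-cong v≈0 w≈0) (+ᴹ-identityˡ 0ᴹ))
    ; *∈   = λ x (lift v≈0) → lift (≈ᴹ-trans (*ₗ-congˡ v≈0) (*ₗ-zeroʳ x))
    }

  _∩_ : Pred → Pred → Pred
  (A ∩ B) v = A v × B v

  ∩-isSubspace : ∀ {A B} → IsSubspace A → IsSubspace B → IsSubspace (A ∩ B)
  ∩-isSubspace S T = record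
    { resp = λ v≈w (a , b) → resp S v≈w a , resp T v≈w b
    ; 0∈   = 0∈ S , 0∈ T
    ; +∈   = λ (a , b) (a′ , b′) → +∈ S a a′ , +∈ T b b′
    ; *∈   = λ x (a , b) → *∈ S x a , *∈ T x b
    }

  infixl 5 _⊞_
  -- The sum of A and the line through `c`, as the vectors that some multiple of `c` moves into A.
  -- Only a scalar has to be found, and there are finitely many, so decidability passes from A to
  -- the sum.
  _⊞_ : Pred → Carrierᴹ → Pred
  (A ⊞ c) v = ∃[ x ] A (x *ₗ c +ᴹ v)

  module _ {A : Pred} (S : IsSubspace A) {c : Carrierᴹ} where

    ⊞-isSubspace : IsSubspace (A ⊞ c)
    ⊞-isSubspace = record
      { resp = λ v≈w (x , h) → x , resp S (+ᴹ-congˡ v≈w) h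
      ; 0∈   = F.0# , resp S (≈ᴹ-sym (≈ᴹ-trans (+ᴹ-identityʳ _) (*ₗ-zeroˡ c))) (0∈ S)
      ; +∈   = λ (x , h) (y , k) → x F.+ y ,
                 resp S (≈ᴹ-trans (interchange _ _ _ _) (+ᴹ-congʳ (≈ᴹ-sym (*ₗ-distribʳ c x y)))) (+∈ S h k)
      ; *∈   = λ y (x , h) → y F.* x ,
                 resp S (≈ᴹ-trans (*ₗ-distribˡ y _ _) (+ᴹ-congʳ (≈ᴹ-sym (*ₗ-assoc y x c)))) (*∈ S y h)
      }

    ⊆-⊞ : A ⊆ A ⊞ c
    ⊆-⊞ {v} v∈ = F.0# , resp S (≈ᴹ-sym (≈ᴹ-trans (+ᴹ-congʳ (*ₗ-zeroˡ c)) (+ᴹ-identityˡ v))) v∈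

    ∈-⊞ : (A ⊞ c) c
    ∈-⊞ = F.- F.1# , resp S (≈ᴹ-sym (-1#*v+v≈0 c)) (0∈ S)

    ⊞-dec : (∀ v → Dec (A v)) → ∀ v → Dec ((A ⊞ c) v)
    ⊞-dec A? v = map′ (λ (i , h) → decode i , h)
      (λ (x , h) → encode x , resp S (+ᴹ-congʳ (*ₗ-congʳ (F.sym (decode-encode x)))) h)
      (Fin.any? (λ i → A? (decode i *ₗ c +ᴹ v)))

  ⊞-least : ∀ {A B c} → IsSubspace B → A ⊆ B → B c → A ⊞ c ⊆ B
  ⊞-least T A⊆B c∈B (x , h) = cancelˡ T (*∈ T x c∈B) (A⊆B h)

  Span : Pred → ∀ {k} → Vector Carrierᴹ k → Pred
  Span A {zero}  r = A
  Span A {suc k} r = Span A (r ∘ suc) ⊞ r zero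

  module _ {A : Pred} (S : IsSubspace A) where

    Span-isSubspace : ∀ {k} (r : Vector Carrierᴹ k) → IsSubspace (Span A r)
    Span-isSubspace {zero}  r = S
    Span-isSubspace {suc k} r = ⊞-isSubspace (Span-isSubspace (r ∘ suc))

    ⊆-Span : ∀ {k} (r : Vector Carrierᴹ k) → A ⊆ Span A r
    ⊆-Span {zero}  r v∈ = v∈
    ⊆-Span {suc k} r v∈ = ⊆-⊞ (Span-isSubspace (r ∘ suc)) (⊆-Span (r ∘ suc) v∈)

    ∈-Span : ∀ {k} (r : Vector Carrierᴹ k) i → Span A r (r i)
    ∈-Span r zero    = ∈-⊞ (Span-isSubspace (r ∘ suc))
    ∈-Span r (suc i) = ⊆-⊞ (Span-isSubspace (r ∘ suc)) (∈-Span (r ∘ suc) i)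

    Span-dec : (∀ v → Dec (A v)) → ∀ {k} (r : Vector Carrierᴹ k) v → Dec (Span A r v)
    Span-dec A? {zero}  r = A?
    Span-dec A? {suc k} r = ⊞-dec (Span-isSubspace (r ∘ suc)) (Span-dec A? (r ∘ suc))

    Span⇒lin : ∀ {k} (r : Vector Carrierᴹ k) {v} → Span A r v → ∃[ a ] A (lin a r +ᴹ v)
    Span⇒lin {zero}  r {v} v∈ = Vector.[] , resp S (≈ᴹ-sym (+ᴹ-identityˡ v)) v∈
    Span⇒lin {suc k} r {v} (x , h) with a , h′ ← Span⇒lin (r ∘ suc) h = x Vector.∷ a , resp S
      (≈ᴹ-trans (≈ᴹ-sym (+ᴹ-assoc _ _ v)) (+ᴹ-congʳ (+ᴹ-comm _ _))) h′

  Span-least : ∀ {A B} → IsSubspace B → A ⊆ B → ∀ {k} (r : Vector Carrierᴹ k) → (∀ i → B (r i)) → Span A r ⊆ B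
  Span-least T A⊆B {zero}  r r∈B = A⊆B
  Span-least T A⊆B {suc k} r r∈B = ⊞-least T (Span-least T A⊆B (r ∘ suc) (r∈B ∘ suc)) (r∈B zero)

  -- Linear independence modulo A; working relative to A replaces the quotient space in which an
  -- interval above A would otherwise be described.
  Independent : Pred → ∀ {k} → Vector Carrierᴹ k → Set _
  Independent A r = ∀ a → A (lin a r) → ∀ i → a i ≈ F.0#

  module _ {A : Pred} (S : IsSubspace A) {k : ℕ} (r : Vector Carrierᴹ (suc k)) where

    independent-tail : Independent A r → Independent (A ⊞ r zero) (r ∘ suc)
    independent-tail ind a (x , h) i = ind (x Vector.∷ a) h (suc i)

    independent-head : Independent A r → ∀ {x} → A (x *ₗ r zero) → x ≈ F.0#
    independent-head ind {x} h = ind (x Vector.∷ (λ _ → F.0#))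
      (resp S (≈ᴹ-sym (≈ᴹ-trans (+ᴹ-congˡ (lin-zero (r ∘ suc) (λ _ → F.refl))) (+ᴹ-identityʳ _))) h) zero

    independent⇒∉ : Independent A r → ¬ A (r zero)
    independent⇒∉ ind h = F.1≉0 (independent-head ind (resp S (≈ᴹ-sym (*ₗ-identityˡ (r zero))) h))

    independent-∷ : ¬ A (r zero) → Independent (A ⊞ r zero) (r ∘ suc) → Independent A r
    independent-∷ r₀∉ ind a h = λ where
        zero    → coefficient≈0 S r₀∉ (resp S (≈ᴹ-trans (+ᴹ-congˡ (lin-zero (r ∘ suc) tail≈0)) (+ᴹ-identityʳ _)) h)
        (suc i) → tail≈0 i
      where
      tail≈0 = ind (a ∘ suc) (a zero , h)

  independent⇒∉Span : ∀ {A k} (S : IsSubspace A) (r : Vector Carrierᴹ (suc k)) → Independent A r → ¬ Span A (r ∘ suc) (r zero)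
  independent⇒∉Span S r ind h with a , h′ ← Span⇒lin S (r ∘ suc) h =
    F.1≉0 (ind (F.1# Vector.∷ a) (resp S (≈ᴹ-trans (+ᴹ-comm _ _) (+ᴹ-congʳ (≈ᴹ-sym (*ₗ-identityˡ (r zero))))) h′) zero)

  transpose : ∀ {x c v u} → x *ₗ c +ᴹ v ≈ᴹ u → v ≈ᴹ F.- x *ₗ c +ᴹ u
  transpose {x} {c} {v} {u} eq = begin
    v                                 ≈⟨ +ᴹ-identityˡ v ⟨
    0ᴹ +ᴹ v                           ≈⟨ +ᴹ-congʳ (≈ᴹ-trans (*ₗ-congʳ (F.-‿inverseˡ x)) (*ₗ-zeroˡ c)) ⟨
    (F.- x F.+ x) *ₗ c +ᴹ v           ≈⟨ *ₗ-+ᴹ-assoc (F.- x) x c v ⟩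
    F.- x *ₗ c +ᴹ (x *ₗ c +ᴹ v)       ≈⟨ +ᴹ-congˡ eq ⟩
    F.- x *ₗ c +ᴹ u                   ∎

  ∷-independent : ∀ {A v k} (S : IsSubspace A) {r : Vector Carrierᴹ k} → ¬ A v → (∀ i → A (r i)) →
    (∀ a → lin a r ≈ᴹ 0ᴹ → ∀ i → a i ≈ F.0#) → ∀ a → lin a (v Vector.∷ r) ≈ᴹ 0ᴹ → ∀ i → a i ≈ F.0#
  ∷-independent {v = v} S {r} v∉ r∈ ind a h = λ where
      zero    → a₀≈0
      (suc i) → ind (a ∘ suc) (begin
        lin (a ∘ suc) r                   ≈⟨ +ᴹ-identityˡ _ ⟨
        0ᴹ +ᴹ lin (a ∘ suc) r             ≈⟨ +ᴹ-congʳ (≈ᴹ-trans (*ₗ-congʳ a₀≈0) (*ₗ-zeroˡ v)) ⟨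
        a zero *ₗ v +ᴹ lin (a ∘ suc) r    ≈⟨ h ⟩
        0ᴹ                                ∎) i
    where
    a₀≈0 = coefficient≈0 S v∉ (cancelʳ S (lin∈ S (a ∘ suc) r∈) (resp S (≈ᴹ-sym h) (0∈ S)))

  -- Realises the recursive description of `Echelon` in the frame `c`: either `c zero` is itself a
  -- basis vector, or a basis of the image modulo `c zero` is lifted along the linear form stored in
  -- `graph`.
  rows : ∀ {n k} → Echelon q n k → Vector Carrierᴹ n → Vector Carrierᴹ k
  rows []          c = c
  rows (pivot s)   c = c zero Vector.∷ rows s (c ∘ suc)
  rows (graph φ s) c = shift (decode ∘ lookup φ) (c zero) (rows s (c ∘ suc))

  rows∈ : ∀ {B n k} → IsSubspace B → (s : Echelon q n k) (c : Vector Carrierᴹ n) → (∀ i → B (c i)) → ∀ j → B (rows s c j)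
  rows∈ T []          c c∈ ()
  rows∈ T (pivot s)   c c∈ zero    = c∈ zero
  rows∈ T (pivot s)   c c∈ (suc j) = rows∈ T s (c ∘ suc) (c∈ ∘ suc) j
  rows∈ T (graph φ s) c c∈ j       = +∈ T (*∈ T _ (c∈ zero)) (rows∈ T s (c ∘ suc) (c∈ ∘ suc) j)

  rows-independent : ∀ {A n k} → IsSubspace A → (s : Echelon q n k) (c : Vector Carrierᴹ n) →
    Independent A c → Independent A (rows s c)
  rows-independent S []          c ind = ind
  rows-independent S (pivot s)   c ind = independent-∷ S (rows (pivot s) c) (independent⇒∉ S c ind)
    (rows-independent (⊞-isSubspace S) s (c ∘ suc) (independent-tail S c ind))
  rows-independent S (graph φ s) c ind a h
    with x , eq ← lin-shift a (decode ∘ lookup φ) (c zero) (rows s (c ∘ suc)) =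
    rows-independent (⊞-isSubspace S) s (c ∘ suc) (independent-tail S c ind) a (x , resp S eq h)

  -- Adding multiples of `v` to the vectors of `r` changes nothing modulo `v`. This lets the
  -- induction on graphs move `c zero` into A.
  Span-⊞ : ∀ {A k} (S : IsSubspace A) (r : Vector Carrierᴹ k) v (φ : Vector K k) →
    Span (A ⊞ v) r ⊆ Span A (shift φ v r) ⊞ v × Span A (shift φ v r) ⊞ v ⊆ Span (A ⊞ v) r
  Span-⊞ {A} S r v φ =
      Span-least T (⊞-least T (λ h → ⊆-⊞ T′ (⊆-Span S r′ h)) v∈T) r
        (λ i → cancelˡ T (*∈ T (φ i) v∈T) (⊆-⊞ T′ (∈-Span S r′ i)))
    , ⊞-least U (Span-least U (λ h → ⊆-Span (⊞-isSubspace S) r (⊆-⊞ S h)) r′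
        (λ i → +∈ U (*∈ U (φ i) v∈U) (∈-Span (⊞-isSubspace S) r i))) v∈U
    where
    r′ = shift φ v r
    T′ = Span-isSubspace S r′
    T = ⊞-isSubspace T′ {v}
    v∈T = ∈-⊞ T′ {v}
    U = Span-isSubspace (⊞-isSubspace S {v}) r
    v∈U = ⊆-Span (⊞-isSubspace S) r (∈-⊞ S)

  -- `Span` adjoins the head last, whereas the inductions put it into A first; the generated
  -- subspace is the same.
  Span-∷ : ∀ {A k} (S : IsSubspace A) (r : Vector Carrierᴹ k) v →
    Span (A ⊞ v) r ⊆ Span A r ⊞ v × Span A r ⊞ v ⊆ Span (A ⊞ v) r
  Span-∷ S r v =
      Span-least (⊞-isSubspace T) (⊞-least (⊞-isSubspace T) (λ h → ⊆-⊞ T (⊆-Span S r h)) (∈-⊞ T)) r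
        (λ i → ⊆-⊞ T (∈-Span S r i))
    , ⊞-least U (Span-least U (λ h → ⊆-Span (⊞-isSubspace S) r (⊆-⊞ S h)) r (∈-Span (⊞-isSubspace S) r))
        (⊆-Span (⊞-isSubspace S) r (∈-⊞ S))
    where
    T = Span-isSubspace S r
    U = Span-isSubspace (⊞-isSubspace S {v}) r

  -- A graph meets the line of `r zero` only in 0: independence kills the coefficients of the
  -- shifted vectors, and what remains is a multiple of `r zero` inside A.
  shift-coefficient≈0 : ∀ {A k} (S : IsSubspace A) (r : Vector Carrierᴹ (suc k)) φ → Independent A r →
    ∀ {x} → Span A (shift φ (r zero) (r ∘ suc)) (x *ₗ r zero) → x ≈ F.0#
  shift-coefficient≈0 {A} S r φ ind {x} h
    with a , h′ ← Span⇒lin S (shift φ (r zero) (r ∘ suc)) h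
    with t , eq ← lin-shift a φ (r zero) (r ∘ suc) =
    independent-head S r ind (resp S (≈ᴹ-trans (+ᴹ-congʳ shift≈0) (+ᴹ-identityˡ _)) h′)
    where
    coefficients≈0 : ∀ i → ((t F.+ x) Vector.∷ a) i ≈ F.0#
    coefficients≈0 = ind ((t F.+ x) Vector.∷ a) (resp S (begin
      lin a (shift φ (r zero) (r ∘ suc)) +ᴹ x *ₗ r zero   ≈⟨ +ᴹ-congʳ eq ⟩
      t *ₗ r zero +ᴹ lin a (r ∘ suc) +ᴹ x *ₗ r zero       ≈⟨ +ᴹ-assoc _ _ _ ⟩
      t *ₗ r zero +ᴹ (lin a (r ∘ suc) +ᴹ x *ₗ r zero)     ≈⟨ +ᴹ-congˡ (+ᴹ-comm _ _) ⟩
      t *ₗ r zero +ᴹ (x *ₗ r zero +ᴹ lin a (r ∘ suc))     ≈⟨ *ₗ-+ᴹ-assoc t x _ _ ⟨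
      (t F.+ x) *ₗ r zero +ᴹ lin a (r ∘ suc)              ∎) h′)
    shift≈0 : lin a (shift φ (r zero) (r ∘ suc)) ≈ᴹ 0ᴹ
    shift≈0 = lin-zero _ (coefficients≈0 ∘ suc)

  Echelon-≡ : ∀ {n k k′} → Echelon q n k → Echelon q n k′ → Set
  Echelon-≡ {n} {k} {k′} s s′ = _≡_ {A = ∃ (Echelon q n)} (k , s) (k′ , s′)

  ⊞-mono : ∀ {A B c} → A ⊆ B → A ⊞ c ⊆ B ⊞ c
  ⊞-mono A⊆B (x , h) = x , A⊆B h

  head∉graph : ∀ {A n k} (S : IsSubspace A) (c : Vector Carrierᴹ (suc n)) → Independent A c →
    ∀ φ (s : Echelon q n k) → ¬ Span A (rows (graph φ s) c) (c zero)
  head∉graph S c ind φ s h = F.1≉0 (shift-coefficient≈0 S (rows (pivot s) c) (decode ∘ lookup φ)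
    (rows-independent S (pivot s) c ind) (resp (Span-isSubspace S (rows (graph φ s) c)) (≈ᴹ-sym (*ₗ-identityˡ (c zero))) h))

  -- Whether `c zero` lies in the span tells `pivot` from `graph`. Modulo `c zero` the smaller forms
  -- agree by induction. For two graphs over the same image, the difference of the j-th rows is a
  -- multiple of `c zero` in the span, so the linear forms agree.
  rows-injective : ∀ {A n k k′} (S : IsSubspace A) (c : Vector Carrierᴹ n) → Independent A c →
    (s : Echelon q n k) (s′ : Echelon q n k′) →
    Span A (rows s c) ⊆ Span A (rows s′ c) → Span A (rows s′ c) ⊆ Span A (rows s c) → Echelon-≡ s s′
  rows-injective S c ind []          []            _  _  = refl
  rows-injective S c ind (pivot s)   (pivot s′)    ⊆₁ ⊆₂
    with refl ← rows-injective (⊞-isSubspace S) (c ∘ suc) (independent-tail S c ind) s s′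
      (λ h → proj₂ (Span-∷ S (rows s′ (c ∘ suc)) (c zero)) (⊆₁ (proj₁ (Span-∷ S (rows s (c ∘ suc)) (c zero)) h)))
      (λ h → proj₂ (Span-∷ S (rows s (c ∘ suc)) (c zero)) (⊆₂ (proj₁ (Span-∷ S (rows s′ (c ∘ suc)) (c zero)) h))) = refl
  rows-injective S c ind (pivot s)   (graph φ s′)  ⊆₁ _  =
    contradiction (⊆₁ (∈-Span S (rows (pivot s) c) zero)) (head∉graph S c ind φ s′)
  rows-injective S c ind (graph φ s) (pivot s′)    _  ⊆₂ =
    contradiction (⊆₂ (∈-Span S (rows (pivot s′) c) zero)) (head∉graph S c ind φ s)
  rows-injective S c ind (graph {k = k} φ s) (graph φ′ s′) ⊆₁ ⊆₂
    with refl ← rows-injective (⊞-isSubspace S) (c ∘ suc) (independent-tail S c ind) s s′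
      (λ h → proj₂ (Span-⊞ S (rows s′ (c ∘ suc)) (c zero) (decode ∘ lookup φ′))
        (⊞-mono {B = Span _ (rows (graph φ′ s′) c)} ⊆₁ (proj₁ (Span-⊞ S (rows s (c ∘ suc)) (c zero) (decode ∘ lookup φ)) h)))
      (λ h → proj₂ (Span-⊞ S (rows s (c ∘ suc)) (c zero) (decode ∘ lookup φ))
        (⊞-mono {B = Span _ (rows (graph φ s) c)} ⊆₂ (proj₁ (Span-⊞ S (rows s′ (c ∘ suc)) (c zero) (decode ∘ lookup φ′)) h)))
    = cong (λ φ → k , graph φ s) (lookup-injective (λ j → decode-injective (x-y≈0⇒x≈y
        (shift-coefficient≈0 S (rows (pivot s) c) (decode ∘ lookup φ′) (rows-independent S (pivot s) c ind) (difference j)))))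
    where
    T = Span-isSubspace S (rows (graph φ′ s) c)
    difference : ∀ j → Span _ (rows (graph φ′ s) c) ((decode (lookup φ j) F.- decode (lookup φ′ j)) *ₗ c zero)
    difference j = cancelʳ T (∈-Span S (rows (graph φ′ s) c) j) (resp T (≈ᴹ-sym
      (≈ᴹ-trans (≈ᴹ-sym (*ₗ-+ᴹ-assoc _ _ _ _)) (+ᴹ-congʳ (*ₗ-congʳ ([x-y]+y≈x _ _)))))
      (⊆₁ (∈-Span S (rows (graph φ s) c) j)))

  -- The case c zero ∉ A applies the induction hypothesis to (A ∩ B) ⊞ c zero.
  rows-complete : ∀ {A n} → IsSubspace A → (∀ v → Dec (A v)) → (c : Vector Carrierᴹ n) →
    ∃[ k ] Σ[ s ∈ Echelon q n k ] (∀ j → A (rows s c j))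
      × (∀ a → A (lin a c) → ∀ B → IsSubspace B → (∀ j → B (rows s c j)) → B (lin a c))
  rows-complete {n = zero}  S A? c = 0 , [] , (λ ()) , (λ a _ B T _ → 0∈ T)
  rows-complete {A} {suc n} S A? c with A? (c zero)
  ... | yes c₀∈ with k , s , s∈ , complete ← rows-complete S A? (c ∘ suc) =
    suc k , pivot s , (λ { zero → c₀∈ ; (suc j) → s∈ j }) , λ a a∈ B T B∋ →
      +∈ T (*∈ T (a zero) (B∋ zero))
        (complete (a ∘ suc) (cancelˡ S (*∈ S (a zero) c₀∈) a∈) B T (B∋ ∘ suc))
  ... | no c₀∉ with k , s , s∈ , complete ← rows-complete (⊞-isSubspace S {c zero}) (⊞-dec S A?) (c ∘ suc) =
    k , graph φ s , graph∈ , λ a a∈ B T B∋ →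
      -- The tail of the combination lies in (A ∩ B) ⊞ c₀, so x c₀ + tail lies in A ∩ B for some x.
      -- As a₀ c₀ + tail lies in A and c₀ does not, x = a₀, which places the whole combination in B.
      let x , A∋ , B∋′ = complete (a ∘ suc) (a zero , a∈) ((A ∩ B) ⊞ c zero) (⊞-isSubspace (∩-isSubspace S T))
                           (λ j → decode (lookup φ j) , graph∈ j , B∋ j)
      in resp T (+ᴹ-congʳ (*ₗ-congʳ (coefficients≈ S c₀∉ A∋ a∈))) B∋′
    where
    φ : Vec (Fin q) k
    φ = tabulate (λ j → encode (proj₁ (s∈ j)))
    graph∈ : ∀ j → A (rows (graph φ s) c j)
    graph∈ j = resp S (+ᴹ-congʳ (*ₗ-congʳ (F.sym (F.trans (F.reflexive (cong decode (lookup∘tabulate _ j)))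
      (decode-encode _))))) (proj₂ (s∈ j))

  -- A sieve: a vector of `w` is kept exactly when it lies outside the span of A and the vectors
  -- kept before it. That every kept vector comes from `w` will keep the frame of [U, V] inside V.
  extend-to-basis : ∀ {A} → IsSubspace A → (∀ v → Dec (A v)) → ∀ {k} (w : Vector Carrierᴹ k) →
    ∃[ n ] Σ[ c ∈ Vector Carrierᴹ n ] Independent A c × (∀ i → ∃[ j ] c i ≡ w j) × (∀ j → Span A c (w j))
  extend-to-basis S A? {zero}  w = 0 , Vector.[] , (λ _ _ ()) , (λ ()) , (λ ())
  extend-to-basis {A} S A? {suc k} w with A? (w zero)
  ... | yes w₀∈ with n , c , ind , c⊆w , w∈ ← extend-to-basis S A? (w ∘ suc) =
    n , c , ind , (λ i → let j , eq = c⊆w i in suc j , eq) , λ { zero → ⊆-Span S c w₀∈ ; (suc j) → w∈ j }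
  ... | no w₀∉ with n , c , ind , c⊆w , w∈ ← extend-to-basis (⊞-isSubspace S {w zero}) (⊞-dec S A?) (w ∘ suc) =
    suc n , w zero Vector.∷ c , independent-∷ S (w zero Vector.∷ c) w₀∉ ind
    , (λ { zero → zero , refl ; (suc i) → let j , eq = c⊆w i in suc j , eq })
    , (λ { zero → ∈-Span S (w zero Vector.∷ c) zero ; (suc j) → proj₁ (Span-∷ S c (w zero)) (w∈ j) })

-- Finite-dimensional subspaces (iii).

module Subspaces {c ℓ : Level} (q : ℕ) (F : CommutativeRing c ℓ) (isFiniteField : IsFiniteField q F) where

  private
    module F = CommutativeRing F
  open F∞ using (coord; finitelySupported)

  F∞-semimodule : LeftSemimodule F.semiring (c l⊔ ℓ) ℓ
  F∞-semimodule = record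
    { _≈ᴹ_ = _≈ᴹ_
    ; _+ᴹ_ = _+ᴹ_
    ; 0ᴹ   = 0ᴹ
    ; _*ₗ_ = _*ₗ_
    ; isLeftSemimodule = record
      { +ᴹ-isCommutativeMonoid = record
        { isMonoid = record
          { isSemigroup = record
            { isMagma = record
              { isEquivalence = record
                { refl  = λ _ → F.refl
                ; sym   = λ v≈w n → F.sym (v≈w n)
                ; trans = λ u≈v v≈w n → F.trans (u≈v n) (v≈w n)
                }
              ; ∙-cong = λ u≈ v≈ n → F.+-cong (u≈ n) (v≈ n)
              }
            ; assoc = λ u v w n → F.+-assoc (coord u n) (coord v n) (coord w n)
            }
          ; identity = (λ v n → F.+-identityˡ (coord v n)) , (λ v n → F.+-identityʳ (coord v n))
          }
        ; comm = λ v w n → F.+-comm (coord v n) (coord w n)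
        }
      ; isPreleftSemimodule = record
        { *ₗ-cong      = λ x≈ v≈ n → F.*-cong x≈ (v≈ n)
        ; *ₗ-zeroˡ     = λ v n → F.zeroˡ (coord v n)
        ; *ₗ-distribʳ  = λ v x y n → F.distribʳ (coord v n) x y
        ; *ₗ-identityˡ = λ v n → F.*-identityˡ (coord v n)
        ; *ₗ-assoc     = λ x y v n → F.*-assoc x y (coord v n)
        ; *ₗ-zeroʳ     = λ x n → F.zeroʳ x
        ; *ₗ-distribˡ  = λ x v w n → F.distribˡ x (coord v n) (coord w n)
        }
      }
    }
    where
    open RawLeftSemimodule (F∞-rawModule F)

  open LeftSemimodule F∞-semimodule
  open LinearAlgebra F isFiniteField F∞-semimodule
  open IsSubspace
  open IsFiniteField isFiniteField using (1≉0)
  open FiniteDimSubspace using (member; basis; basis∈; spanning; independent)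

  isSubspace : ∀ U → IsSubspace (member {F = F} U)
  isSubspace U = record
    { resp = λ {v} {w} → FiniteDimSubspace.resp U {v} {w}
    ; 0∈   = FiniteDimSubspace.0-closed U
    ; +∈   = λ {v} {w} → FiniteDimSubspace.+-closed U {v} {w}
    ; *∈   = λ x {v} → FiniteDimSubspace.*-closed U x {v}
    }

  -- Finite support leaves only finitely many coordinates to test.
  0ᴹ? : ∀ v → Dec (Zero v)
  0ᴹ? v = map′ (λ low → lift (everywhere (λ n n<N → low {n} n<N))) (λ (lift v≈0) {n} _ → v≈0 n)
      (ℕ.allUpTo? (λ n → coord v n ≟ F.0#) N)
    where
    N = proj₁ (finitelySupported v)
    everywhere : (∀ n → n ℕ.< N → coord v n F.≈ F.0#) → ∀ n → coord v n F.≈ F.0#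
    everywhere low n with n ℕ.<? N
    ... | yes n<N = low n n<N
    ... | no n≮N  = proj₂ (finitelySupported v) n (ℕ.≮⇒≥ n≮N)

  -- `member` is an arbitrary predicate, but the basis makes it equivalent to a span over 0, which
  -- is decided by searching the finite field for coefficients.
  member? : ∀ U v → Dec (member {F = F} U v)
  member? U v = map′
    (Span-least (isSubspace U) (λ {w} (lift w≈0) → resp (isSubspace U) {0ᴹ} {w} (≈ᴹ-sym {w} {0ᴹ} w≈0) (0∈ (isSubspace U))) (basis U) (basis∈ U))
    (λ v∈ → let a , v≈ = spanning U v∈ in
      resp S {lin a (basis U)} {v} (≈ᴹ-sym {v} {lin a (basis U)} v≈) (lin∈ S a (∈-Span Zero-isSubspace (basis U))))
    (Span-dec Zero-isSubspace 0ᴹ? (basis U) v)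
    where S = Span-isSubspace Zero-isSubspace (basis U)

  _⊑?_ : ∀ U V → Dec (_⊑_ F U V)
  U ⊑? V = map′
    (λ basis∈V {v} v∈U → let a , v≈ = spanning U v∈U in
      resp (isSubspace V) {lin a (basis U)} {v} (≈ᴹ-sym {v} {lin a (basis U)} v≈) (lin∈ (isSubspace V) a basis∈V))
    (λ U⊑V i → U⊑V (basis∈ U i))
    (Fin.all? (λ i → member? V (basis U i)))

  dim-mono : ∀ U V → _⊑_ F U V → dim U ℕ.≤ dim V
  dim-mono U V U⊑V = independent⇒≤ (basis U) (basis V) (independent U)
    (λ a → spanning V (U⊑V (lin∈ (isSubspace U) a (basis∈ U))))

  adjoin : ∀ U v → ¬ member {F = F} U v → FiniteDimSubspace F
  adjoin U v v∉U = record
    { member      = member U ⊞ v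
    ; resp        = λ {u} {w} → resp S {u} {w}
    ; 0-closed    = 0∈ S
    ; +-closed    = λ {u} {w} → +∈ S {u} {w}
    ; *-closed    = λ x {u} → *∈ S x {u}
    ; dim         = suc (dim U)
    ; basis       = v Vector.∷ basis U
    ; basis∈      = λ { zero → ∈-⊞ (isSubspace U) {v} ; (suc i) → ⊆-⊞ (isSubspace U) {v} {basis U i} (basis∈ U i) }
    ; spanning    = λ {w} (x , h) → let a , eq = spanning U h in
        F.- x Vector.∷ a , transpose {x} {v} {w} {lin a (basis U)} eq
    ; independent = ∷-independent (isSubspace U) {r = basis U} v∉U (basis∈ U) (independent U)
    }
    where S = ⊞-isSubspace (isSubspace U) {v}

  zero-subspace : FiniteDimSubspace F
  zero-subspace = record
    { member      = Zero
    ; resp        = λ {v} {w} → resp Zero-isSubspace {v} {w}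
    ; 0-closed    = 0∈ Zero-isSubspace
    ; +-closed    = λ {v} {w} → +∈ Zero-isSubspace {v} {w}
    ; *-closed    = λ x {v} → *∈ Zero-isSubspace x {v}
    ; dim         = 0
    ; basis       = Vector.[]
    ; basis∈      = λ ()
    ; spanning    = λ (lift v≈0) → Vector.[] , v≈0
    ; independent = λ _ _ ()
    }

  zero-⊑ : ∀ U → _⊑_ F zero-subspace U
  zero-⊑ U {v} (lift v≈0) = resp (isSubspace U) {0ᴹ} {v} (≈ᴹ-sym {v} {0ᴹ} v≈0) (0∈ (isSubspace U))

  -- Turns a span into an element of the poset. Each adjoined vector is new by independence and
  -- raises the dimension by exactly one, which gives the heights in the frame.
  extend : ∀ U {k} (r : Vector (F∞ F) k) → Independent (member U) r →
    Σ[ V ∈ FiniteDimSubspace F ] (∀ {v} → member V v → Span (member U) r v)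
      × (∀ {v} → Span (member U) r v → member V v) × dim V ≡ k ℕ.+ dim U
  extend U {zero}  r ind = U , (λ v∈ → v∈) , (λ v∈ → v∈) , refl
  extend U {suc k} r ind =
    let V , V⊆ , ⊆V , dim≡ = extend U (r ∘ suc) (λ a h → independent-tail (isSubspace U) r ind a (⊆-⊞ (isSubspace U) {r zero} {lin a (r ∘ suc)} h))
    in adjoin V (r zero) (λ r₀∈V → independent⇒∉Span (isSubspace U) r ind (V⊆ r₀∈V))
      , (λ (x , h) → x , V⊆ h) , (λ (x , h) → x , ⊆V h) , cong suc dim≡

  dim-cong : ∀ {U V} → _⊑_ F U V → _⊑_ F V U → dim U ≡ dim V
  dim-cong {U} {V} U⊑V V⊑U = ℕ.≤-antisym (dim-mono U V U⊑V) (dim-mono V U V⊑U)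

  frame : ∀ {U V} → _⊑_ F U V → Frame (finiteDimSubspaces F) dim q U V
  frame {U} {V} U⊑V =
    let n , c , ind , c⊆basis , basis∈c = extend-to-basis (isSubspace U) (member? U) (basis V)
        c∈V : ∀ i → member V (c i)
        c∈V i = let j , eq = c⊆basis i in subst (member V) (sym eq) (basis∈ V j)
    in frame-along c ind c∈V (λ {v} v∈V →
         let a , v≈ = spanning V v∈V
             S = Span-isSubspace (isSubspace U) c
         in resp S {lin a (basis V)} {v} (≈ᴹ-sym {v} {lin a (basis V)} v≈) (lin∈ S a basis∈c))
    where
    SU = isSubspace U
    frame-along : ∀ {n} (c : Vector (F∞ F) n) → Independent (member U) c → (∀ i → member V (c i)) →
      (∀ {v} → member V v → Span (member U) c v) → Frame (finiteDimSubspaces F) dim q U V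
    frame-along {n} c ind c∈V V⊆ = record
      { embed        = embed
      ; height-top   = trans (dim-cong {V} {proj₁ top} (λ v∈ → proj₁ (proj₂ (proj₂ top)) (V⊆ v∈))
                         (λ v∈ → Span-least (isSubspace V) U⊑V c c∈V (proj₁ (proj₂ top) v∈)))
                         (proj₂ (proj₂ (proj₂ top)))
      ; height-embed = λ s → proj₂ (proj₂ (proj₂ (extension s)))
      ; x≤embed      = λ s v∈U → Span⊆embed s (⊆-Span SU (rows s c) v∈U)
      ; embed≤y      = λ s v∈ → Span-least (isSubspace V) U⊑V (rows s c) (rows∈ (isSubspace V) s c c∈V) (embed⊆Span s v∈)
      ; injective    = λ s s′ eq → rows-injective SU c ind s s′
                         (λ v∈ → embed⊆Span s′ (lhs≤rhs eq (Span⊆embed s v∈))) (λ v∈ → embed⊆Span s (rhs≤lhs eq (Span⊆embed s′ v∈)))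
      ; complete     = λ {W} U⊑W W⊑V →
          let k , s , rows∈W , W⊆ = rows-complete (isSubspace W) (member? W) c
          in k , s , record
            { lhs≤rhs = λ {w} w∈W →
                -- Modulo U, w is the negative of a combination of the frame. That combination lies
                -- in W because U does, hence in the embedded subspace, and w follows by
                -- cancellation.
                let a , h = Span⇒lin SU c {w} (V⊆ (W⊑V w∈W))
                    T = isSubspace (embed s)
                    lin∈W = cancelʳ (isSubspace W) {lin a c} {w} w∈W (U⊑W h)
                    lin∈T = W⊆ a lin∈W (member (embed s)) T (λ j → Span⊆embed s (∈-Span SU (rows s c) j))
                in cancelˡ T {lin a c} {w} lin∈T (Span⊆embed s (⊆-Span SU (rows s c) h))
            ; rhs≤lhs = λ v∈ → Span-least (isSubspace W) U⊑W (rows s c) rows∈W (embed⊆Span s v∈)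
            }
      }
      where
      top = extend U c ind
      extension : ∀ {k} (s : Echelon q n k) → _
      extension s = extend U (rows s c) (rows-independent SU s c ind)
      embed : ∀ {k} → Echelon q n k → FiniteDimSubspace F
      embed s = proj₁ (extension s)
      embed⊆Span : ∀ {k} (s : Echelon q n k) {v} → member (embed s) v → Span (member U) (rows s c) v
      embed⊆Span s = proj₁ (proj₂ (extension s))
      Span⊆embed : ∀ {k} (s : Echelon q n k) {v} → Span (member U) (rows s c) v → member (embed s) v
      Span⊆embed s = proj₁ (proj₂ (proj₂ (extension s)))

  unit : ℕ → F∞ F
  unit n = record
    { coord             = λ m → if does (m ℕ.≟ n) then F.1# else F.0#
    ; finitelySupported = suc n , λ m n<m → F.reflexive (cong (if_then F.1# else F.0#) (dec-false (m ℕ.≟ n) (ℕ.>⇒≢ n<m)))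
    }

  -- Supplies intervals of every rank, so that the typing is surjective. The bound on supports is
  -- carried along because it keeps `unit n` outside the n-th space.
  flag : ∀ n → Σ[ V ∈ FiniteDimSubspace F ] dim V ≡ n × (∀ {v} → member V v → ∀ m → n ℕ.≤ m → coord v m F.≈ F.0#)
  flag zero    = zero-subspace , refl , λ (lift v≈0) m _ → v≈0 m
  flag (suc n) =
    let V , dim≡ , V≈0 = flag n
    in adjoin V (unit n) (λ e∈V → 1≉0 (F.trans (F.reflexive (sym (cong (if_then F.1# else F.0#) (dec-true (n ℕ.≟ n) refl))))
           (V≈0 e∈V n ℕ.≤-refl)))
      , cong suc dim≡
      , λ {v} (x , h) m n<m → F.trans (F.sym (F.trans
          (F.+-congʳ (F.trans (F.*-congˡ (proj₂ (finitelySupported (unit n)) m n<m)) (F.zeroʳ x))) (F.+-identityˡ (coord v m))))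
          (V≈0 h m (ℕ.<⇒≤ n<m))

  echelonPoset : EchelonPoset q (finiteDimSubspaces F)
  echelonPoset = record
    { height      = dim
    ; height-cong = λ {U} {V} U≈V → dim-cong {U} {V} (lhs≤rhs U≈V) (rhs≤lhs U≈V)
    ; _≤?_        = _⊑?_
    ; frame       = λ {U} {V} → frame {U} {V}
    ; unbounded   = λ n → let V , dim≡ , _ = flag n in
        zero-subspace , V , (λ {v} → zero-⊑ V {v}) , trans dim≡ (sym (ℕ.+-identityʳ n))
    }

open import Data.Nat.Base using (_+_)

theorem1p8 : ∀ {c ℓ} →
  (Σ[ T ∈ SurjectiveTyping ℕ⁺-divisibility ]
    (∀ n m → Poset._≤_ ℕ⁺-divisibility n m → SurjectiveTyping.type T n m ≡ val m / val n)
    × PropertyR T)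
  × (Σ[ T ∈ SurjectiveTyping finiteSubsets ]
    (∀ A B → Poset._≤_ finiteSubsets A B → SurjectiveTyping.type T A B ≡ card B ∸ card A + 1)
    × PropertyR T)
  × (∀ (q : ℕ) (F : CommutativeRing c ℓ) → IsFiniteField q F →
    Σ[ T ∈ SurjectiveTyping (finiteDimSubspaces F) ]
    (∀ U V → Poset._≤_ (finiteDimSubspaces F) U V → SurjectiveTyping.type T U V ≡ dim V ∸ dim U + 1)
    × PropertyR T)
  × (Σ[ T ∈ SurjectiveTyping ℕ⁺-usual ]
    (∀ n m → Poset._≤_ ℕ⁺-usual n m → SurjectiveTyping.type T n m ≡ val m ∸ val n + 1)
    × ¬ PropertyR T)
theorem1p8 =
    (ModelledTyping.typing Divisibility.modelledTyping
      , (λ n m n∣m → Divisibility.type-∣ {n} {m} n∣m)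
      , divisibility-propertyR)
  , (EchelonPoset.typing FiniteSubsets.echelonPoset
      , (λ A B A⊆B → EchelonPoset.typing-type FiniteSubsets.echelonPoset {A} {B} A⊆B)
      , echelon-propertyR FiniteSubsets.echelonPoset)
  , (λ q F isFiniteField →
        EchelonPoset.typing (Subspaces.echelonPoset q F isFiniteField)
      , (λ U V U⊑V → EchelonPoset.typing-type (Subspaces.echelonPoset q F isFiniteField) {U} {V} U⊑V)
      , echelon-propertyR {{ℕ.>-nonZero (ℕ.<-trans (s≤s z≤n) (LinearAlgebra.1<q F isFiniteField (Subspaces.F∞-semimodule q F isFiniteField)))}}
          (Subspaces.echelonPoset q F isFiniteField))
  , (EchelonPoset.typing usualPoset
      , (λ n m n≤m → EchelonPoset.typing-type usualPoset {n} {m} n≤m)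
      , usual-¬propertyR)
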